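{- Let $n\ge1$, let $\xi\in\mathbb{C}^n$ be a unit vector, and let $\varphi_\xi$ be the vector state on $M_n$ given by $\varphi_\xi(B)=\langle\xi,B\xi\rangle=\xi^*B\xi$. Let $A\in M_n$ be Hermitian with distinct eigenvalues $\lambda_1,\ldots,\lambda_s$ of respective multiplicities $n_1,\ldots,n_s$, and let $\Lambda=\lambda_1I_{n_1}\oplus\cdots\oplus\lambda_sI_{n_s}$. Suppose that $U=[U_1\ U_2\ \cdots\ U_s]\in M_n$ is a unitary matrix such that $A=U\Lambda U^*$, where for each $i=1,\ldots,s$, $U_i=[u_1^{(i)}\ u_2^{(i)}\ \cdots\ u_{n_i}^{(i)}]$ is an $n\times n_i$ matrix whose columns $u_1^{(i)},\ldots,u_{n_i}^{(i)}$ are unit eigenvectors of $A$ corresponding to $\lambda_i$. Then there exists a unique discrete probability measure $\mu$ on $\mathbb{R}$ such that $$\varphi_\xi(A^k)=\int_{\mathbb{R}}x^k\,d\mu(x)\quad\text{for all }k\in\mathbb{N},$$ and it has the form $\mu=\sum_{i=1}^s\omega_i\delta_{\lambda_i}$. Furthermore, $\omega_i=\sum_{j=1}^{n_i}|\cos\theta_j^{(i)}|^2$ for each $i$, where $\theta_j^{(i)}$ is the angle between $u_j^{(i)}$ and $\xi$.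
   Context: $M_n$ is the set of $n\times n$ complex matrices and $\mathbb{N}=\{0,1,2,\ldots\}$. The inner product $\langle\cdot,\cdot\rangle$ on $\mathbb{C}^n$ is the usual one, conjugate-linear in the first argument. $\delta_\lambda$ is the Dirac measure at $\lambda\in\mathbb{R}$. A discrete measure on $\mathbb{R}$ is a Borel measure concentrated on a countable set. For unit vectors $u,\xi\in\mathbb{C}^n$, the angle $\theta$ between $u$ and $\xi$ is understood through $\cos\theta=\langle u,\xi\rangle$, so that $|\cos\theta|^2=|\langle u,\xi\rangle|^2$. -}

module Defs where

open import Algebra.Bundles using (CommutativeRing; RawRing; Semiring)
import Algebra.Construct.NaturalChoice.Max as NaturalMax
import Algebra.Definitions.RawMonoid as RawMonoidDefs
import Algebra.Definitions.RawSemiring as RawSemiringDefs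
open import Axiom.ExcludedMiddle using (ExcludedMiddle)
open import Data.Bool.Base using (if_then_else_)
open import Data.Fin.Base using (Fin; zero; suc; toℕ)
open import Data.Fin.Properties using (_≟_)
open import Data.Nat.Base as ℕ using (ℕ; zero; suc)
open import Data.Product.Base using (Σ-syntax; ∃; _×_)
open import Data.Vec.Functional using (Vector; []; _++_; head; tail; map; replicate)
open import Function.Bundles using (_⇔_)
open import Level using (0ℓ)
open import Relation.Binary.Bundles using (TotalOrder)
open import Relation.Binary.Core using (Rel)
open import Relation.Binary.PropositionalEquality.Core using (_≢_)
open import Relation.Binary.Structures using (IsTotalOrder)
open import Relation.Nullary.Decidable.Core using (⌊_⌋)
open import Relation.Nullary.Negation.Core using (¬_)
open import Relation.Unary using (Pred; _∈_; _≐_; _⊥_)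

module Supremum {A : Set} (_≤_ : Rel A 0ℓ) where

  UpperBound : Pred A 0ℓ → Pred A 0ℓ
  UpperBound P u = ∀ x → P x → x ≤ u

  IsSup : Pred A 0ℓ → Pred A 0ℓ
  IsSup P s = UpperBound P s × (∀ u → UpperBound P u → s ≤ u)

-- The library has no real numbers.  Classically a complete ordered field is ℝ up to a
-- unique isomorphism, so ℝ is represented by an arbitrary one.
record CompleteOrderedField : Set₁ where
  infix 4 _≤_ _<_
  field
    commutativeRing : CommutativeRing 0ℓ 0ℓ
  open CommutativeRing commutativeRing public
    using (Carrier; _≈_; _≉_; _+_; _*_; -_; _-_; 0#; 1#)
  field
    _≤_          : Rel Carrier 0ℓ
    isTotalOrder : IsTotalOrder _≈_ _≤_
    0≉1          : 0# ≉ 1#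
    inverse      : ∀ x → x ≉ 0# → Σ[ y ∈ Carrier ] x * y ≈ 1#
    +-mono-≤     : ∀ x y z → x ≤ y → x + z ≤ y + z
    *-nonNeg     : ∀ x y → 0# ≤ x → 0# ≤ y → 0# ≤ x * y
  open Supremum _≤_ public
  field
    complete     : (P : Pred Carrier 0ℓ) → ∃ P → ∃ (UpperBound P) → ∃ (IsSup P)

  totalOrder : TotalOrder 0ℓ 0ℓ 0ℓ
  totalOrder = record { isTotalOrder = isTotalOrder }

  _<_ : Rel Carrier 0ℓ
  x < y = x ≤ y × x ≉ y

  open NaturalMax totalOrder public using (_⊔_)
  open CommutativeRing commutativeRing using (semiring; +-rawMonoid)
  open RawSemiringDefs (Semiring.rawSemiring semiring) public using (_^_)
  open RawMonoidDefs +-rawMonoid public using () renaming (sum to ∑)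

open RawMonoidDefs ℕ.+-0-rawMonoid public using () renaming (sum to ∑ℕ)

module Complex (𝓡 : CompleteOrderedField) where

  open CompleteOrderedField 𝓡 public renaming (Carrier to ℝ)

  infix  4 _≈ᶜ_ _≈ᵛ_ _≈ᴹ_
  infixl 6 _⊕_
  infixl 7 _·_ _·ᵛ_ _∙ᵛ_
  infixr 8 _^ᴹ_
  infix  9 _ᴴ

  record ℂ : Set where
    constructor _+i_
    field
      re : ℝ
      im : ℝ
  open ℂ public

  _≈ᶜ_ : Rel ℂ 0ℓ
  z ≈ᶜ w = re z ≈ re w × im z ≈ im w

  ℂ-rawRing : RawRing 0ℓ 0ℓ
  ℂ-rawRing = record
    { Carrier = ℂ
    ; _≈_     = _≈ᶜ_
    ; _+_     = λ z w → (re z + re w) +i (im z + im w)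
    ; _*_     = λ z w → (re z * re w - im z * im w) +i (re z * im w + im z * re w)
    ; -_      = λ z → (- re z) +i (- im z)
    ; 0#      = 0# +i 0#
    ; 1#      = 1# +i 0#
    }

  open RawRing ℂ-rawRing public using ()
    renaming (_+_ to _+ᶜ_; _*_ to _*ᶜ_; 0# to 0ᶜ; 1# to 1ᶜ)
  open RawMonoidDefs (RawRing.+-rawMonoid ℂ-rawRing) public using ()
    renaming (sum to ∑ᶜ)

  ofReal : ℝ → ℂ
  ofReal x = x +i 0#

  conj : ℂ → ℂ
  conj z = re z +i (- im z)

  ∣_∣² : ℂ → ℝ
  ∣ z ∣² = re z * re z + im z * im z

  ℂ^ : ℕ → Set
  ℂ^ n = Vector ℂ n

  Matrix : ℕ → ℕ → Set
  Matrix p q = Vector (Vector ℂ q) p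

  M : ℕ → Set
  M n = Matrix n n

  _≈ᵛ_ : ∀ {n} → Rel (ℂ^ n) 0ℓ
  u ≈ᵛ v = ∀ i → u i ≈ᶜ v i

  _≈ᴹ_ : ∀ {p q} → Rel (Matrix p q) 0ℓ
  A ≈ᴹ B = ∀ i j → A i j ≈ᶜ B i j

  0ᵛ : ∀ {n} → ℂ^ n
  0ᵛ {n} = replicate n 0ᶜ

  _∙ᵛ_ : ∀ {n} → ℂ → ℂ^ n → ℂ^ n
  z ∙ᵛ v = map (z *ᶜ_) v

  ⟨_,_⟩ : ∀ {n} → ℂ^ n → ℂ^ n → ℂ
  ⟨ u , v ⟩ = ∑ᶜ λ i → conj (u i) *ᶜ v i

  IsUnit : ∀ {n} → Pred (ℂ^ n) 0ℓ
  IsUnit v = ⟨ v , v ⟩ ≈ᶜ 1ᶜ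

  -- cos θ, where θ is the (possibly complex) angle between the unit vectors u and v.
  cosAngle : ∀ {n} → ℂ^ n → ℂ^ n → ℂ
  cosAngle u v = ⟨ u , v ⟩

  col : ∀ {p q} → Matrix p q → Fin q → ℂ^ p
  col A j i = A i j

  _·ᵛ_ : ∀ {p q} → Matrix p q → ℂ^ q → ℂ^ p
  (A ·ᵛ v) i = ∑ᶜ λ j → A i j *ᶜ v j

  _·_ : ∀ {p q r} → Matrix p q → Matrix q r → Matrix p r
  (A · B) i k = ∑ᶜ λ j → A i j *ᶜ B j k

  _ᴴ : ∀ {p q} → Matrix p q → Matrix q p
  (A ᴴ) i j = conj (A j i)

  I : ∀ {n} → M n
  I i j = if ⌊ i ≟ j ⌋ then 1ᶜ else 0ᶜ

  scalar : ∀ {n} → ℂ → M n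
  scalar z i j = z *ᶜ I i j

  _^ᴹ_ : ∀ {n} → M n → ℕ → M n
  A ^ᴹ zero  = I
  A ^ᴹ suc k = A · (A ^ᴹ k)

  IsHermitian : ∀ {n} → Pred (M n) 0ℓ
  IsHermitian A = A ᴴ ≈ᴹ A

  IsUnitary : ∀ {n} → Pred (M n) 0ℓ
  IsUnitary U = (U ᴴ · U ≈ᴹ I) × (U · U ᴴ ≈ᴹ I)

  vectorState : ∀ {n} → ℂ^ n → M n → ℂ
  vectorState ξ B = ⟨ ξ , B ·ᵛ ξ ⟩

  IsEigenvector : ∀ {n} → M n → ℂ → Pred (ℂ^ n) 0ℓ
  IsEigenvector A z v = ¬ (v ≈ᵛ 0ᵛ) × (A ·ᵛ v ≈ᵛ z ∙ᵛ v)

  IsEigenvalue : ∀ {n} → M n → Pred ℂ 0ℓ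
  IsEigenvalue A z = ∃ (IsEigenvector A z)

  lincomb : ∀ {n m} → Vector ℂ m → Vector (ℂ^ n) m → ℂ^ n
  lincomb c b i = ∑ᶜ λ j → c j *ᶜ b j i

  -- The eigenspace of z has a basis of m vectors.  For Hermitian matrices geometric and
  -- algebraic multiplicities agree.
  HasMultiplicity : ∀ {n} → M n → ℂ → ℕ → Set
  HasMultiplicity {n} A z m = Σ[ b ∈ Vector (ℂ^ n) m ]
    (∀ j → A ·ᵛ b j ≈ᵛ z ∙ᵛ b j) ×
    (∀ c → lincomb c b ≈ᵛ 0ᵛ → c ≈ᵛ 0ᵛ) ×
    (∀ v → A ·ᵛ v ≈ᵛ z ∙ᵛ v → Σ[ c ∈ Vector ℂ m ] v ≈ᵛ lincomb c b)

  -- [ V₁ V₂ ⋯ Vₛ ]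
  hcat : ∀ {p s} (m : Vector ℕ s) → (∀ i → Matrix p (m i)) → Matrix p (∑ℕ m)
  hcat {s = zero}  m V r = []
  hcat {s = suc s} m V r = V zero r ++ hcat (tail m) (λ i → V (suc i)) r

  _⊕_ : ∀ {p q} → M p → M q → M (p ℕ.+ q)
  _⊕_ {p} {q} A B = map (_++ 0ᵛ {q}) A ++ map (0ᵛ {p} ++_) B

  ⨁ : ∀ {s} (m : Vector ℕ s) → (∀ i → M (m i)) → M (∑ℕ m)
  ⨁ {zero}  m D = []
  ⨁ {suc s} m D = D zero ⊕ ⨁ (tail m) (λ i → D (suc i))

module Measure (𝓡 : CompleteOrderedField) where

  open CompleteOrderedField 𝓡 renaming (Carrier to ℝ)

  -- Codes for the σ-algebra generated by the open intervals; a Borel set is a subset of ℝ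
  -- of the form ⟦ B ⟧.  Codes keep quantification over Borel sets predicative.
  data Borel : Set where
    ⦅_،_⦆ : ℝ → ℝ → Borel
    ∁_    : Borel → Borel
    ⋃     : (ℕ → Borel) → Borel

  ⟦_⟧ : Borel → Pred ℝ 0ℓ
  ⟦ ⦅ a ، b ⦆ ⟧ x = a < x × x < b
  ⟦ ∁ B ⟧       x = ¬ (x ∈ ⟦ B ⟧)
  ⟦ ⋃ B ⟧       x = Σ[ k ∈ ℕ ] x ∈ ⟦ B k ⟧

  univ : Borel
  univ = ∁ ⦅ 0# ، 0# ⦆

  SumsTo : (ℕ → ℝ) → ℝ → Set
  SumsTo a l = ∀ ε → 0# < ε → Σ[ N ∈ ℕ ] ∀ k → N ℕ.≤ k →
    let S = ∑ {k} (λ i → a (toℕ i)) in (l - ε < S) × (S < l + ε)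

  record ProbabilityMeasure : Set where
    field
      mass        : Borel → ℝ
      mass-cong   : ∀ B C → ⟦ B ⟧ ≐ ⟦ C ⟧ → mass B ≈ mass C
      mass-nonNeg : ∀ B → 0# ≤ mass B
      mass-univ   : mass univ ≈ 1#
      mass-⋃      : ∀ (B : ℕ → Borel) → (∀ i j → i ≢ j → ⟦ B i ⟧ ⊥ ⟦ B j ⟧) →
                    SumsTo (λ k → mass (B k)) (mass (⋃ B))
  open ProbabilityMeasure public

  _≈ᵐ_ : Rel ProbabilityMeasure 0ℓ
  μ ≈ᵐ ν = ∀ B → mass μ B ≈ mass ν B

  IsCountable : Pred (Pred ℝ 0ℓ) 0ℓ
  IsCountable P = Σ[ e ∈ (ℕ → ℝ) ] ∀ x → x ∈ P → Σ[ k ∈ ℕ ] x ≈ e k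

  IsDiscrete : Pred ProbabilityMeasure 0ℓ
  IsDiscrete μ = Σ[ S ∈ Borel ] IsCountable ⟦ S ⟧ × mass μ (∁ S) ≈ 0#

  Dirac : ExcludedMiddle 0ℓ → ℝ → Borel → ℝ
  Dirac em a B = if ⌊ em {a ∈ ⟦ B ⟧} ⌋ then 1# else 0#

  IsMeasurable : Pred (ℝ → ℝ) 0ℓ
  IsMeasurable f = ∀ c → Σ[ B ∈ Borel ] ∀ x → (x ∈ ⟦ B ⟧ ⇔ f x < c)

  -- t is the integral of a nonnegative simple function Σ cᵢ 1_{Bᵢ} ≤ f, with disjoint Bᵢ;
  -- the pointwise bound is expressed on each Bᵢ, so this is meant for f ≥ 0 only.
  IsLowerSum : ProbabilityMeasure → (ℝ → ℝ) → Pred ℝ 0ℓ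
  IsLowerSum μ f t = Σ[ p ∈ ℕ ] Σ[ c ∈ Vector ℝ p ] Σ[ B ∈ Vector Borel p ]
    (∀ i → 0# ≤ c i) ×
    (∀ i j → i ≢ j → ⟦ B i ⟧ ⊥ ⟦ B j ⟧) ×
    (∀ i x → x ∈ ⟦ B i ⟧ → c i ≤ f x) ×
    t ≈ ∑ (λ i → c i * mass μ (B i))

  -- f is Lebesgue integrable with respect to μ, and r = ∫ f⁺ dμ - ∫ f⁻ dμ.
  HasIntegral : ProbabilityMeasure → (ℝ → ℝ) → Pred ℝ 0ℓ
  HasIntegral μ f r = IsMeasurable f × Σ[ a ∈ ℝ ] Σ[ b ∈ ℝ ]
    IsSup (IsLowerSum μ (λ x → f x ⊔ 0#)) a ×
    IsSup (IsLowerSum μ (λ x → (- f x) ⊔ 0#)) b ×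
    r ≈ a - b

module Submission where

-- Expanding ξ in the orthonormal basis of columns of U gives φ_ξ(Aᵏ) = Σ ωᵢ λᵢᵏ, so the
-- atomic measure Σ ωᵢ δ_{λᵢ} has the required moments.  Conversely, a discrete measure ν is a
-- series Σ wₖ δ_{pₖ}, its integrals are the sums of the corresponding series, and hence
-- Σ wₖ f(pₖ) = Σ ωᵢ f(λᵢ) for every polynomial f.  For f = Π (x - λᵢ)² the right-hand side
-- vanishes, so ν is concentrated on the λᵢ; an f interpolating the indicator function of a
-- Borel set B at the λᵢ then gives ν(B) = Σ ωᵢ δ_{λᵢ}(B).

open import Defs
open import Algebra.Bundles using (CommutativeMonoid; CommutativeRing; RawRing)
import Algebra.Construct.NaturalChoice.Max as NaturalMax
import Algebra.Definitions.RawMonoid as RawMonoidDefinitions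
import Algebra.Properties.AbelianGroup as AbelianGroupProperties
import Algebra.Properties.CommutativeMonoid.Sum as CommutativeMonoidSum
import Algebra.Properties.CommutativeSemigroup as CommutativeSemigroupProperties
import Algebra.Properties.Ring as RingProperties
import Algebra.Properties.Semiring.Mult.TCOptimised as SemiringMult
import Algebra.Properties.Semiring.Sum as SemiringSum
import Algebra.Solver.Ring as RingSolver
open import Algebra.Solver.Ring.AlmostCommutativeRing using (fromCommutativeRing; _-Raw-AlmostCommutative⟶_)
open import Axiom.ExcludedMiddle using (ExcludedMiddle)
open import Data.Empty using (⊥-elim)
open import Data.Fin.Base using (Fin; zero; suc; toℕ; splitAt; _↑ˡ_; _↑ʳ_)
open import Data.Fin.Properties using (_≟_; splitAt-↑ˡ; splitAt-↑ʳ; suc-injective; toℕ-injective)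
open import Data.Maybe.Base using (Maybe; just; nothing)
open import Data.Nat.Base as ℕ using (ℕ; zero; suc; z≤n; s≤s)
import Data.Nat.Properties as ℕₚ
open import Data.Product using (Σ; Σ-syntax; ∃; ∃!; _×_; _,_; proj₁; proj₂)
open import Data.Sum.Base using (_⊎_; inj₁; inj₂; [_,_]′)
open import Data.Vec.Functional using (Vector)
open import Function.Base using (_∘_)
open import Function.Bundles using (_⇔_; mk⇔; Equivalence)
open import Function.Definitions using (Injective)
open import Level using (0ℓ)
open import Relation.Binary.Definitions using (tri<; tri≈; tri>)
open import Relation.Binary.PropositionalEquality as ≡ using (_≡_; _≢_; subst)
open import Relation.Binary.Structures using (IsTotalOrder)
open import Relation.Nullary using (¬_; yes; no)
open import Relation.Unary using (Pred; _∈_; _∉_; _⊆_; _≐_; _⊥_)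

-- Equality of all moments does not determine a measure in general; what settles it here is that one
-- of the two measures has finite support. The competitor ν may still have infinitely many atoms
-- anywhere on the line, so its moments are infinite series with terms of both signs. Its integrals
-- are differences of suprema of lower sums, and linearity is awkward to prove for these. Hence the
-- only integrals of ν that are ever expanded are those of the powers of x; polynomials are formed
-- afterwards, among convergent series, where sums and multiples are easy. The square in the
-- polynomial vanishing at the eigenvalues is there for its sign: a series of nonnegative terms with
-- sum zero has only zero terms, while a signed series would say nothing about a single atom.
-- Existence has its own cost, since integrability includes Borel measurability of the powers, and
-- Borel sets are codes built from bounded open intervals.

-- A ring solver with integer coefficients.

module Solver {c ℓ} (R : CommutativeRing c ℓ) where
  open CommutativeRing R
  open RingProperties ring using (x[y-z]≈xy-xz; [y-z]x≈yx-zx; -0#≈0#)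
  open AbelianGroupProperties +-abelianGroup using (⁻¹-anti-homo‿-; ⁻¹-∙-comm)
  open CommutativeSemigroupProperties (CommutativeRing.+-commutativeSemigroup R) using (interchange)
  open SemiringMult semiring using (×-homo-+; ×1-homo-*) renaming (_×_ to _•_)
  open import Relation.Binary.Reasoning.Setoid setoid

  -- Coefficients of the solver: (a , b) stands for the integer a - b.
  Difference : Set
  Difference = Σ ℕ λ _ → ℕ

  differenceRing : RawRing _ _
  differenceRing = record
    { Carrier = Difference
    ; _≈_     = _≡_
    ; _+_     = λ { (a , b) (c , d) → a ℕ.+ c , b ℕ.+ d }
    ; _*_     = λ { (a , b) (c , d) → a ℕ.* c ℕ.+ b ℕ.* d , a ℕ.* d ℕ.+ b ℕ.* c }
    ; -_      = λ { (a , b) → b , a }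
    ; 0#      = 0 , 0
    ; 1#      = 1 , 0
    }

  -- The separate clause for `zero` makes `(0 , 0)` and `(1 , 0)` evaluate definitionally to `0#`
  -- and `1#`, so that `0-homo` and `1-homo` are `refl` and solved identities mention the constants
  -- themselves.
  value : Difference → Carrier
  value (a , zero)  = a • 1#
  value (a , suc b) = a • 1# - suc b • 1#

  value≈ : ∀ a b → value (a , b) ≈ a • 1# - b • 1#
  value≈ a zero    = sym (trans (+-congˡ -0#≈0#) (+-identityʳ _))
  value≈ a (suc b) = refl

  -‿interchange : ∀ w x y z → (w + x) - (y + z) ≈ (w - y) + (x - z)
  -‿interchange w x y z = trans (+-congˡ (sym (⁻¹-∙-comm y z))) (interchange w x (- y) (- z))

  morphism : differenceRing -Raw-AlmostCommutative⟶ fromCommutativeRing R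
  morphism = record
    { ⟦_⟧    = value
    ; +-homo = λ { (a , b) (c , d) → begin
        value (a ℕ.+ c , b ℕ.+ d)                        ≈⟨ value≈ (a ℕ.+ c) (b ℕ.+ d) ⟩
        (a ℕ.+ c) • 1# - (b ℕ.+ d) • 1#                  ≈⟨ +-cong (×-homo-+ 1# a c) (-‿cong (×-homo-+ 1# b d)) ⟩
        (a • 1# + c • 1#) - (b • 1# + d • 1#)            ≈⟨ -‿interchange _ _ _ _ ⟩
        (a • 1# - b • 1#) + (c • 1# - d • 1#)            ≈⟨ +-cong (value≈ a b) (value≈ c d) ⟨
        value (a , b) + value (c , d)                    ∎ }
    ; *-homo = λ { (a , b) (c , d) → begin
        value (a ℕ.* c ℕ.+ b ℕ.* d , a ℕ.* d ℕ.+ b ℕ.* c)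
          ≈⟨ value≈ (a ℕ.* c ℕ.+ b ℕ.* d) (a ℕ.* d ℕ.+ b ℕ.* c) ⟩
        (a ℕ.* c ℕ.+ b ℕ.* d) • 1# - (a ℕ.* d ℕ.+ b ℕ.* c) • 1#
          ≈⟨ +-cong (expand a c b d) (-‿cong (expand a d b c)) ⟩
        (a • 1# * c • 1# + b • 1# * d • 1#) - (a • 1# * d • 1# + b • 1# * c • 1#)
          ≈⟨ -‿interchange _ _ _ _ ⟩
        (a • 1# * c • 1# - a • 1# * d • 1#) + (b • 1# * d • 1# - b • 1# * c • 1#)
          ≈⟨ +-congˡ (⁻¹-anti-homo‿- _ _) ⟨
        (a • 1# * c • 1# - a • 1# * d • 1#) - (b • 1# * c • 1# - b • 1# * d • 1#)
          ≈⟨ +-cong (x[y-z]≈xy-xz _ _ _) (-‿cong (x[y-z]≈xy-xz _ _ _)) ⟨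
        a • 1# * (c • 1# - d • 1#) - b • 1# * (c • 1# - d • 1#)
          ≈⟨ [y-z]x≈yx-zx _ _ _ ⟨
        (a • 1# - b • 1#) * (c • 1# - d • 1#)
          ≈⟨ *-cong (value≈ a b) (value≈ c d) ⟨
        value (a , b) * value (c , d) ∎ }
    ; -‿homo = λ { (a , b) → begin
        value (b , a)             ≈⟨ value≈ b a ⟩
        b • 1# - a • 1#           ≈⟨ ⁻¹-anti-homo‿- _ _ ⟨
        - (a • 1# - b • 1#)       ≈⟨ -‿cong (value≈ a b) ⟨
        - value (a , b)           ∎ }
    ; 0-homo = refl
    ; 1-homo = refl
    }
    where
    expand : ∀ a c b d → (a ℕ.* c ℕ.+ b ℕ.* d) • 1# ≈ a • 1# * c • 1# + b • 1# * d • 1#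
    expand a c b d = trans (×-homo-+ 1# (a ℕ.* c) (b ℕ.* d)) (+-cong (×1-homo-* a c) (×1-homo-* b d))

  -- Different pairs can stand for the same integer, so the test is `a + d = c + b` rather than
  -- equality of components; `shift` brings both pairs to the same representative.
  _≟′_ : ∀ x y → Maybe (value x ≈ value y)
  (a , b) ≟′ (c , d) with a ℕ.+ d ℕₚ.≟ c ℕ.+ b
  ... | no  _  = nothing
  ... | yes eq = just (begin
    value (a , b)                         ≈⟨ value≈ a b ⟩
    a • 1# - b • 1#                       ≈⟨ shift a b d ⟩
    (a ℕ.+ d) • 1# - (b ℕ.+ d) • 1#       ≡⟨ ≡.cong₂ (λ m n → m • 1# - n • 1#) eq (ℕₚ.+-comm b d) ⟩
    (c ℕ.+ b) • 1# - (d ℕ.+ b) • 1#       ≈⟨ shift c d b ⟨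
    c • 1# - d • 1#                       ≈⟨ value≈ c d ⟨
    value (c , d)                         ∎)
    where
    shift : ∀ a b d → a • 1# - b • 1# ≈ (a ℕ.+ d) • 1# - (b ℕ.+ d) • 1#
    shift a b d = begin
      a • 1# - b • 1#                         ≈⟨ +-identityʳ _ ⟨
      (a • 1# - b • 1#) + 0#                  ≈⟨ +-congˡ (-‿inverseʳ (d • 1#)) ⟨
      (a • 1# - b • 1#) + (d • 1# - d • 1#)   ≈⟨ -‿interchange _ _ _ _ ⟨
      (a • 1# + d • 1#) - (b • 1# + d • 1#)   ≈⟨ +-cong (×-homo-+ 1# a d) (-‿cong (×-homo-+ 1# b d)) ⟨
      (a ℕ.+ d) • 1# - (b ℕ.+ d) • 1#         ∎

  open RingSolver differenceRing (fromCommutativeRing R) morphism _≟′_ public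
    using (solve; _:=_; _:+_; _:*_; _:-_; :-_; con; Polynomial)

  :0 :1 : ∀ {n} → Polynomial n
  :0 = con (0 , 0)
  :1 = con (1 , 0)

-- The block and the position inside the block of a column of a concatenation of blocks.
mutual
  block : ∀ {s} (m : Vector ℕ s) → Fin (∑ℕ m) → Σ (Fin s) (λ i → Fin (m i))
  block {suc s} m c = blockFromSplit m (splitAt (m zero) c)

  -- The result of `splitAt` is an explicit argument so that `∑-block` can rewrite it by congruence.
  blockFromSplit : ∀ {s} (m : Vector ℕ (suc s)) → Fin (m zero) ⊎ Fin (∑ℕ (m ∘ suc)) → Σ (Fin (suc s)) (λ i → Fin (m i))
  blockFromSplit m (inj₁ j) = zero , j
  blockFromSplit m (inj₂ c) = let i , j = block (m ∘ suc) c in suc i , j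

-- Finite sums in commutative monoids and rings.

module FiniteSum {c ℓ} (M : CommutativeMonoid c ℓ) where
  open CommutativeMonoid M renaming
    ( _∙_ to _+_; ε to 0#; ∙-cong to +-cong; ∙-congˡ to +-congˡ
    ; identityˡ to +-identityˡ; identityʳ to +-identityʳ; assoc to +-assoc )
  open CommutativeMonoidSum M public using (∑-distrib-+; ∑-comm)
  open CommutativeMonoidSum M using (sum; sum-cong-≋; sum-cong-≗; sum-replicate-zero)

  ∑-cong : ∀ {n} {f g : Vector Carrier n} → (∀ i → f i ≈ g i) → sum f ≈ sum g
  ∑-cong {f = f} {g} = sum-cong-≋ {x = f} {g}

  ∑-zero : ∀ {n} {f : Vector Carrier n} → (∀ i → f i ≈ 0#) → sum f ≈ 0#
  ∑-zero {n} f≈0 = trans (∑-cong f≈0) (sum-replicate-zero n)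

  ∑-single : ∀ {n} {f : Vector Carrier n} i → (∀ j → j ≢ i → f j ≈ 0#) → sum f ≈ f i
  ∑-single zero    f≈0 = trans (+-congˡ (∑-zero λ j → f≈0 (suc j) λ ())) (+-identityʳ _)
  ∑-single (suc i) f≈0 =
    trans (+-cong (f≈0 zero λ ()) (∑-single i λ j j≢i → f≈0 (suc j) λ { ≡.refl → j≢i ≡.refl })) (+-identityˡ _)

  ∑-↑ : ∀ m {n} (f : Vector Carrier (m ℕ.+ n)) → sum f ≈ sum (λ i → f (i ↑ˡ n)) + sum (λ i → f (m ↑ʳ i))
  ∑-↑ zero    f = sym (+-identityˡ _)
  ∑-↑ (suc m) f = trans (+-congˡ (∑-↑ m (f ∘ suc))) (sym (+-assoc _ _ _))

  ∑-block : ∀ {s} (m : Vector ℕ s) (f : ∀ i → Fin (m i) → Carrier) →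
              sum (λ c → let i , j = block m c in f i j) ≈ sum (λ i → sum (f i))
  ∑-block {zero}  m f = refl
  ∑-block {suc s} m f = trans (∑-↑ (m zero) _) (+-cong
    (reflexive (sum-cong-≗ λ j → ≡.cong (λ x → at (blockFromSplit m x)) (splitAt-↑ˡ (m zero) j _)))
    (trans (reflexive (sum-cong-≗ λ c → ≡.cong (λ x → at (blockFromSplit m x)) (splitAt-↑ʳ (m zero) _ c)))
           (∑-block (m ∘ suc) (λ i → f (suc i)))))
    where
    at : Σ (Fin (suc s)) (λ i → Fin (m i)) → Carrier
    at (i , j) = f i j

module RingSum {c ℓ} (R : CommutativeRing c ℓ) where
  open CommutativeRing R
  open FiniteSum +-commutativeMonoid public
  open SemiringSum semiring public using (*-distribˡ-sum; *-distribʳ-sum)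
  open CommutativeMonoidSum +-commutativeMonoid using (sum)
  open CommutativeSemigroupProperties *-commutativeSemigroup using (x∙yz≈y∙xz)
  open import Relation.Binary.Reasoning.Setoid setoid

  -- The exchange of sums behind several later facts: associativity of matrices acting on vectors,
  -- linearity of `A` and of the inner product on `lincomb`, and the lower sums of a finite atomic
  -- measure.
  ∑-*-∑-comm : ∀ {p q} (a : Vector Carrier p) (g : Vector Carrier q) (B : Vector (Vector Carrier p) q) →
               sum (λ t → a t * sum (λ c → g c * B c t)) ≈ sum (λ c → g c * sum (λ t → a t * B c t))
  ∑-*-∑-comm {p} {q} a g B = begin
    sum (λ t → a t * sum (λ c → g c * B c t))     ≈⟨ ∑-cong (λ t → *-distribˡ-sum (a t) (λ c → g c * B c t)) ⟩
    sum (λ t → sum (λ c → a t * (g c * B c t)))   ≈⟨ ∑-comm {p} {q} (λ t c → a t * (g c * B c t)) ⟩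
    sum (λ c → sum (λ t → a t * (g c * B c t)))   ≈⟨ ∑-cong {q} (λ c → ∑-cong {p} (λ t → x∙yz≈y∙xz (a t) (g c) (B c t))) ⟩
    sum (λ c → sum (λ t → g c * (a t * B c t)))   ≈⟨ ∑-cong (λ c → *-distribˡ-sum (g c) (λ t → a t * B c t)) ⟨
    sum (λ c → g c * sum (λ t → a t * B c t))     ∎

-- Inequalities in the ordered field of reals.

module OrderedField (em : ExcludedMiddle 0ℓ) (𝓡 : CompleteOrderedField) where
  open CompleteOrderedField 𝓡 renaming (Carrier to ℝ) public
  open CommutativeRing commutativeRing public
    using ( setoid; refl; sym; trans; reflexive; +-cong; +-congˡ; +-congʳ; *-cong; *-congˡ; *-congʳ; -‿cong
          ; +-identityˡ; +-identityʳ; *-identityˡ; *-identityʳ; zeroˡ; zeroʳ; -‿inverseʳ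
          ; +-comm; *-comm; +-commutativeMonoid )
  open Solver commutativeRing public
  open IsTotalOrder isTotalOrder public
    using (≤-respˡ-≈; ≤-respʳ-≈)
    renaming (refl to ≤-refl; trans to ≤-trans; reflexive to ≤-reflexive; antisym to ≤-antisym; total to ≤-total)
  open CommutativeMonoidSum +-commutativeMonoid public using (sum-replicate-zero)
  open RingSum commutativeRing public

  open import Relation.Binary.Reasoning.Setoid setoid

  ≤⇒0≤- : ∀ {x y} → x ≤ y → 0# ≤ y - x
  ≤⇒0≤- {x} {y} x≤y = ≤-respˡ-≈ (-‿inverseʳ x) (+-mono-≤ x y (- x) x≤y)

  -- Inequalities are proved by exhibiting the difference of the two sides, an identity for
  -- the ring solver, as a sum of nonnegative terms.
  ≤-by : ∀ {x y d} → 0# ≤ d → y - x ≈ d → x ≤ y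
  ≤-by {x} {y} {d} 0≤d eq =
    ≤-respʳ-≈ (solve 2 (λ x y → (y :- x) :+ x := y) refl x y)
      (≤-respˡ-≈ (+-identityˡ x) (+-mono-≤ 0# (y - x) x (≤-respʳ-≈ (sym eq) 0≤d)))

  +-nonNeg : ∀ {x y} → 0# ≤ x → 0# ≤ y → 0# ≤ x + y
  +-nonNeg {x} {y} 0≤x 0≤y =
    ≤-trans 0≤y (≤-by 0≤x (solve 2 (λ x y → (x :+ y) :- y := x) refl x y))

  +-mono : ∀ {x y u v} → x ≤ y → u ≤ v → x + u ≤ y + v
  +-mono {x} {y} {u} {v} x≤y u≤v = ≤-by (+-nonNeg (≤⇒0≤- x≤y) (≤⇒0≤- u≤v))
    (solve 4 (λ x y u v → (y :+ v) :- (x :+ u) := (y :- x) :+ (v :- u)) refl x y u v)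

  *-monoˡ : ∀ {x y z} → 0# ≤ z → x ≤ y → z * x ≤ z * y
  *-monoˡ {x} {y} {z} 0≤z x≤y = ≤-by (*-nonNeg z (y - x) 0≤z (≤⇒0≤- x≤y))
    (solve 3 (λ x y z → z :* y :- z :* x := z :* (y :- x)) refl x y z)

  ≤0⇒0≤- : ∀ {x} → x ≤ 0# → 0# ≤ - x
  ≤0⇒0≤- {x} x≤0 = ≤-by (≤⇒0≤- x≤0) (solve 1 (λ x → (:- x) :- :0 := :0 :- x) refl x)

  square-nonNeg : ∀ x → 0# ≤ x * x
  square-nonNeg x with ≤-total 0# x
  ... | inj₁ 0≤x = *-nonNeg x x 0≤x 0≤x
  ... | inj₂ x≤0 = ≤-respʳ-≈ (solve 1 (λ x → (:- x) :* (:- x) := x :* x) refl x)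
                     (*-nonNeg (- x) (- x) (≤0⇒0≤- x≤0) (≤0⇒0≤- x≤0))

  0≤1 : 0# ≤ 1#
  0≤1 = ≤-respʳ-≈ (*-identityˡ 1#) (square-nonNeg 1#)

  0<1 : 0# < 1#
  0<1 = 0≤1 , 0≉1

  noZeroDivisors : ∀ {x y} → x ≉ 0# → x * y ≈ 0# → y ≈ 0#
  noZeroDivisors {x} {y} x≉0 xy≈0 =
    let x⁻¹ , xx⁻¹≈1 = inverse x x≉0 in
    trans (sym (*-identityˡ y)) (trans (*-congʳ (sym xx⁻¹≈1))
      (trans (solve 3 (λ x y z → x :* z :* y := z :* (x :* y)) refl x y x⁻¹)
        (trans (*-congˡ xy≈0) (zeroʳ x⁻¹))))

  <-by : ∀ {x y d} → 0# < d → y - x ≈ d → x < y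
  <-by {x} {y} {d} (0≤d , 0≉d) eq =
    ≤-by 0≤d eq , λ x≈y → 0≉d (trans (sym (-‿inverseʳ y)) (trans (+-congˡ (-‿cong (sym x≈y))) eq))

  <⇒0<- : ∀ {x y} → x < y → 0# < y - x
  <⇒0<- {x} {y} (x≤y , x≉y) = ≤⇒0≤- x≤y , λ 0≈y-x → x≉y (trans (sym (+-identityˡ x))
    (trans (+-congʳ 0≈y-x) (solve 2 (λ x y → (y :- x) :+ x := y) refl x y)))

  ≤-<-trans : ∀ {x y z} → x ≤ y → y < z → x < z
  ≤-<-trans x≤y (y≤z , y≉z) =
    ≤-trans x≤y y≤z , λ x≈z → y≉z (≤-antisym y≤z (≤-respˡ-≈ x≈z x≤y))

  <-≤-trans : ∀ {x y z} → x < y → y ≤ z → x < z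
  <-≤-trans (x≤y , x≉y) y≤z =
    ≤-trans x≤y y≤z , λ x≈z → x≉y (≤-antisym x≤y (≤-respʳ-≈ (sym x≈z) y≤z))

  <-respˡ-≈ : ∀ {x y z} → x ≈ y → x < z → y < z
  <-respˡ-≈ x≈y = ≤-<-trans (≤-reflexive (sym x≈y))

  <-respʳ-≈ : ∀ {x y z} → x ≈ y → z < x → z < y
  <-respʳ-≈ x≈y z<x = <-≤-trans z<x (≤-reflexive x≈y)

  <-irrefl : ∀ {x} → ¬ x < x
  <-irrefl (_ , x≉x) = x≉x refl

  ≰⇒> : ∀ {x y} → ¬ x ≤ y → y < x
  ≰⇒> {x} {y} x≰y with ≤-total x y
  ... | inj₁ x≤y = ⊥-elim (x≰y x≤y)
  ... | inj₂ y≤x = y≤x , λ y≈x → x≰y (≤-reflexive (sym y≈x))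

  <⇒≱ : ∀ {x y} → x < y → ¬ y ≤ x
  <⇒≱ x<y y≤x = <-irrefl (<-≤-trans x<y y≤x)

  ≮⇒≥ : ∀ {x y} → ¬ x < y → y ≤ x
  ≮⇒≥ {x} {y} x≮y with em {y ≤ x}
  ... | yes y≤x = y≤x
  ... | no  y≰x = ⊥-elim (x≮y (≰⇒> y≰x))

  +-pos : ∀ {x y} → 0# < x → 0# ≤ y → 0# < x + y
  +-pos {x} {y} 0<x 0≤y = <-≤-trans 0<x (≤-by 0≤y (solve 2 (λ x y → (x :+ y) :- x := y) refl x y))

  *-pos : ∀ {x y} → 0# < x → 0# < y → 0# < x * y
  *-pos {x} {y} (0≤x , 0≉x) (0≤y , 0≉y) =
    *-nonNeg x y 0≤x 0≤y , λ 0≈xy → 0≉y (sym (noZeroDivisors (0≉x ∘ sym) (sym 0≈xy)))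

  x<x+ε : ∀ {x ε} → 0# < ε → x < x + ε
  x<x+ε {x} {ε} 0<ε = <-by 0<ε (solve 2 (λ x ε → (x :+ ε) :- x := ε) refl x ε)

  x-ε<x : ∀ {x ε} → 0# < ε → x - ε < x
  x-ε<x {x} {ε} 0<ε = <-by 0<ε (solve 2 (λ x ε → x :- (x :- ε) := ε) refl x ε)

  inverse-pos : ∀ {x} → 0# < x → Σ[ y ∈ ℝ ] (0# < y × x * y ≈ 1#)
  inverse-pos {x} (0≤x , 0≉x) with inverse x (0≉x ∘ sym)
  ... | y , xy≈1 = y , (0≤y , λ 0≈y → 0≉1 (trans (sym (zeroʳ x)) (trans (*-congˡ 0≈y) xy≈1))) , xy≈1
    where
    0≤y : 0# ≤ y
    -- The inverse equals `x * (y * y)`, a product of nonnegative factors.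
    0≤y = ≤-respʳ-≈
      (trans (solve 2 (λ x y → x :* (y :* y) := (x :* y) :* y) refl x y) (trans (*-congʳ xy≈1) (*-identityˡ y)))
      (*-nonNeg x (y * y) 0≤x (square-nonNeg y))

  half : ∀ {ε} → 0# < ε → Σ[ δ ∈ ℝ ] (0# < δ × ε ≈ δ + δ)
  half {ε} 0<ε =
    let h , 0<h , 2h≈1 = inverse-pos {1# + 1#} (+-pos 0<1 0≤1) in
    h * ε , *-pos 0<h 0<ε , (begin
      ε                     ≈⟨ *-identityˡ ε ⟨
      1# * ε                ≈⟨ *-congʳ 2h≈1 ⟨
      (1# + 1#) * h * ε     ≈⟨ solve 2 (λ h ε → (:1 :+ :1) :* h :* ε := h :* ε :+ h :* ε) refl h ε ⟩
      h * ε + h * ε         ∎)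

  ≤-approx : ∀ {x y} → (∀ ε → 0# < ε → x < y + ε) → x ≤ y
  ≤-approx {x} {y} h = ≮⇒≥ λ y<x →
    <-irrefl (<-respʳ-≈ y+[x-y]≈x (h (x - y) (<⇒0<- y<x)))
    where
    y+[x-y]≈x : y + (x - y) ≈ x
    y+[x-y]≈x = solve 2 (λ x y → y :+ (x :- y) := x) refl x y

  ∑-mono : ∀ {n} {f g : Vector ℝ n} → (∀ i → f i ≤ g i) → ∑ f ≤ ∑ g
  ∑-mono {zero}  f≤g = ≤-refl
  ∑-mono {suc n} f≤g = +-mono (f≤g zero) (∑-mono (f≤g ∘ suc))

  ∑-nonNeg : ∀ {n} {f : Vector ℝ n} → (∀ i → 0# ≤ f i) → 0# ≤ ∑ f
  ∑-nonNeg {n} 0≤f = ≤-respˡ-≈ (sum-replicate-zero n) (∑-mono {f = λ _ → 0#} 0≤f)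

  ∑-neg : ∀ {n} (f : Vector ℝ n) → ∑ (λ i → - f i) ≈ - ∑ f
  ∑-neg {zero}  f = solve 0 (:0 := :- :0) refl
  ∑-neg {suc n} f = trans (+-congˡ (∑-neg (f ∘ suc)))
    (solve 2 (λ x y → (:- x) :+ (:- y) := :- (x :+ y)) refl (f zero) _)

-- Convergent series of reals.

module Series (em : ExcludedMiddle 0ℓ) (𝓡 : CompleteOrderedField) where
  open OrderedField em 𝓡
  open Measure 𝓡
  open import Relation.Binary.Reasoning.Setoid setoid

  partialSum : (ℕ → ℝ) → ℕ → ℝ
  partialSum a k = ∑ {k} (λ i → a (toℕ i))

  partialSum-mono : ∀ {a m n} → (∀ k → 0# ≤ a k) → m ℕ.≤ n → partialSum a m ≤ partialSum a n
  partialSum-mono {n = n} 0≤a z≤n       = ∑-nonNeg {n} (λ i → 0≤a (toℕ i))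
  partialSum-mono {a}     0≤a (s≤s m≤n) = +-mono ≤-refl (partialSum-mono {a ∘ suc} (λ k → 0≤a (suc k)) m≤n)

  -- A record, so that the sequence can be inferred from the type.
  infix 4 _↝_
  record _↝_ (a : ℕ → ℝ) (l : ℝ) : Set where
    constructor tends
    field sumsTo : SumsTo a l
  open _↝_ public

  ↝-cong : ∀ {a b l m} → (∀ k → a k ≈ b k) → l ≈ m → a ↝ l → b ↝ m
  sumsTo (↝-cong {a} {b} a≈b l≈m a→l) ε 0<ε with sumsTo a→l ε 0<ε
  ... | N , close = N , λ k N≤k → let lower , upper = close k N≤k
                                      S≈ = ∑-cong {k} {λ i → a (toℕ i)} {λ i → b (toℕ i)} (λ i → a≈b (toℕ i)) in
    <-respˡ-≈ (+-congʳ l≈m) (<-respʳ-≈ S≈ lower) , <-respˡ-≈ S≈ (<-respʳ-≈ (+-congʳ l≈m) upper)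

  ↝-0 : ∀ {a} → (∀ k → a k ≈ 0#) → a ↝ 0#
  ↝-0 a≈0 = ↝-cong (λ k → sym (a≈0 k)) refl (tends λ ε 0<ε → 0 , λ k _ →
    <-respʳ-≈ (sym (sum-replicate-zero k)) (x-ε<x 0<ε) ,
    <-respˡ-≈ (sym (sum-replicate-zero k)) (x<x+ε 0<ε))

  ↝-+ : ∀ {a b l m} → a ↝ l → b ↝ m → (λ k → a k + b k) ↝ l + m
  sumsTo (↝-+ {a} {b} {l} {m} a→l b→m) ε 0<ε =
    let δ , 0<δ , ε≈δ+δ = half 0<ε
        N₁ , close₁ = sumsTo a→l δ 0<δ
        N₂ , close₂ = sumsTo b→m δ 0<δ
    in N₁ ℕ.⊔ N₂ , λ k N≤k →
      let lower₁ , upper₁ = close₁ k (ℕₚ.≤-trans (ℕₚ.m≤m⊔n N₁ N₂) N≤k)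
          lower₂ , upper₂ = close₂ k (ℕₚ.≤-trans (ℕₚ.m≤n⊔m N₁ N₂) N≤k)
          S≈ = ∑-distrib-+ {k} (λ i → a (toℕ i)) (λ i → b (toℕ i))
      in
      <-by (+-pos (<⇒0<- lower₁) (proj₁ (<⇒0<- lower₂)))
        (trans (+-cong S≈ (-‿cong (+-congˡ (-‿cong ε≈δ+δ))))
          (solve 5 (λ l m δ x y → (x :+ y) :- ((l :+ m) :- (δ :+ δ)) := (x :- (l :- δ)) :+ (y :- (m :- δ))) refl
            l m δ (partialSum a k) (partialSum b k))) ,
      <-by (+-pos (<⇒0<- upper₁) (proj₁ (<⇒0<- upper₂)))
        (trans (+-cong (+-congˡ ε≈δ+δ) (-‿cong S≈))
          (solve 5 (λ l m δ x y → ((l :+ m) :+ (δ :+ δ)) :- (x :+ y) := ((l :+ δ) :- x) :+ ((m :+ δ) :- y)) refl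
            l m δ (partialSum a k) (partialSum b k)))

  ↝-neg : ∀ {a l} → a ↝ l → (λ k → - a k) ↝ - l
  sumsTo (↝-neg {a} {l} a→l) ε 0<ε =
    let N , close = sumsTo a→l ε 0<ε in N , λ k N≤k →
      let lower , upper = close k N≤k
          S≈ = ∑-neg {k} (λ i → a (toℕ i))
      in
      <-by (<⇒0<- upper) (trans (+-congʳ S≈)
        (solve 3 (λ l ε x → (:- x) :- ((:- l) :- ε) := (l :+ ε) :- x) refl l ε (partialSum a k))) ,
      <-by (<⇒0<- lower) (trans (+-congˡ (-‿cong S≈))
        (solve 3 (λ l ε x → ((:- l) :+ ε) :- (:- x) := x :- (l :- ε)) refl l ε (partialSum a k)))

  ↝-*-nonNeg : ∀ {a l} c → 0# ≤ c → a ↝ l → (λ k → c * a k) ↝ c * l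
  sumsTo (↝-*-nonNeg {a} {l} c 0≤c a→l) ε 0<ε =
    -- Dividing ε by `1# + c` rather than by `c` admits `c ≈ 0#` and leaves a spare `δ`, which makes
    -- both inequalities strict.
    let i , 0<i , [1+c]i≈1 = inverse-pos {1# + c} (+-pos 0<1 0≤c)
        δ = i * ε
        0<δ = *-pos 0<i 0<ε
        ε≈δ+cδ : ε ≈ δ + c * δ
        ε≈δ+cδ = begin
          ε                     ≈⟨ *-identityˡ ε ⟨
          1# * ε                ≈⟨ *-congʳ [1+c]i≈1 ⟨
          (1# + c) * i * ε      ≈⟨ solve 3 (λ c i ε → (:1 :+ c) :* i :* ε := i :* ε :+ c :* (i :* ε)) refl c i ε ⟩
          i * ε + c * (i * ε)   ∎
        N , close = sumsTo a→l δ 0<δ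
    in N , λ k N≤k →
      let lower , upper = close k N≤k
          S≈ = sym (*-distribˡ-sum {k} c (λ i → a (toℕ i)))
      in
      <-by (+-pos 0<δ (*-nonNeg c _ 0≤c (proj₁ (<⇒0<- lower))))
        (trans (+-cong S≈ (-‿cong (+-congˡ (-‿cong ε≈δ+cδ))))
          (solve 4 (λ c l δ x → c :* x :- (c :* l :- (δ :+ c :* δ)) := δ :+ c :* (x :- (l :- δ))) refl
            c l δ (partialSum a k))) ,
      <-by (+-pos 0<δ (*-nonNeg c _ 0≤c (proj₁ (<⇒0<- upper))))
        (trans (+-cong (+-congˡ ε≈δ+cδ) (-‿cong S≈))
          (solve 4 (λ c l δ x → (c :* l :+ (δ :+ c :* δ)) :- c :* x := δ :+ c :* ((l :+ δ) :- x)) refl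
            c l δ (partialSum a k)))

  ↝-* : ∀ {a l} c → a ↝ l → (λ k → c * a k) ↝ c * l
  ↝-* {a} {l} c a→l with ≤-total 0# c
  ... | inj₁ 0≤c = ↝-*-nonNeg c 0≤c a→l
  ... | inj₂ c≤0 = ↝-cong (λ k → neg-* c (a k)) (neg-* c l) (↝-neg (↝-*-nonNeg (- c) (≤0⇒0≤- c≤0) a→l))
    where
    neg-* : ∀ c x → - (- c * x) ≈ c * x
    neg-* = solve 2 (λ c x → :- (:- c :* x) := c :* x) refl

  ↝-∑ : ∀ {n} {a : Fin n → ℕ → ℝ} {l : Vector ℝ n} → (∀ i → a i ↝ l i) →
             (λ k → ∑ (λ i → a i k)) ↝ ∑ l
  ↝-∑ {zero}  a→l = ↝-0 λ _ → refl
  ↝-∑ {suc n} a→l = ↝-+ (a→l zero) (↝-∑ (λ i → a→l (suc i)))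

  ↝-tail : ∀ {a l} → a ↝ l → (λ k → a (suc k)) ↝ l - a 0
  sumsTo (↝-tail {a} {l} a→l) ε 0<ε =
    let N , close = sumsTo a→l ε 0<ε in N , λ k N≤k →
      let lower , upper = close (suc k) (ℕₚ.m≤n⇒m≤1+n N≤k) in
      <-by (<⇒0<- lower)
        (solve 4 (λ l a ε x → x :- ((l :- a) :- ε) := (a :+ x) :- (l :- ε)) refl l (a 0) ε _) ,
      <-by (<⇒0<- upper)
        (solve 4 (λ l a ε x → ((l :- a) :+ ε) :- x := (l :+ ε) :- (a :+ x)) refl l (a 0) ε _)

  ↝-cons : ∀ {a l} → a ∘ suc ↝ l → a ↝ a 0 + l
  sumsTo (↝-cons {a} {l} a→l) ε 0<ε =
    -- The threshold grows by one for the term put in front; it also rules out the empty sum, from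
    -- which no first term can be split off.
    let N , close = sumsTo a→l ε 0<ε in suc N , λ { (suc k) (s≤s N≤k) →
      let lower , upper = close k N≤k in
      <-by (<⇒0<- lower)
        (solve 4 (λ l a ε x → (a :+ x) :- ((a :+ l) :- ε) := x :- (l :- ε)) refl l (a 0) ε _) ,
      <-by (<⇒0<- upper)
        (solve 4 (λ l a ε x → ((a :+ l) :+ ε) :- (a :+ x) := (l :+ ε) :- x) refl l (a 0) ε _) }

  ↝-single : ∀ {a} j → (∀ k → k ≢ j → a k ≈ 0#) → a ↝ a j
  ↝-single zero    a≈0 = ↝-cong (λ _ → refl) (+-identityʳ _)
    (↝-cons (↝-0 (λ k → a≈0 (suc k) λ ())))
  ↝-single (suc j) a≈0 = ↝-cong (λ _ → refl) (trans (+-congʳ (a≈0 0 λ ())) (+-identityˡ _))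
    (↝-cons (↝-single j λ k k≢j → a≈0 (suc k) λ { ≡.refl → k≢j ≡.refl }))

  ↝-≤ : ∀ {a b l m} → (∀ k → partialSum a k ≤ partialSum b k) → a ↝ l → b ↝ m → l ≤ m
  ↝-≤ {a} {b} {l} {m} a≤b a→l b→m = ≤-approx λ ε 0<ε →
    let δ , 0<δ , ε≈δ+δ = half 0<ε
        N₁ , close₁ = sumsTo a→l δ 0<δ
        N₂ , close₂ = sumsTo b→m δ 0<δ
        k = N₁ ℕ.⊔ N₂
        lower = proj₁ (close₁ k (ℕₚ.m≤m⊔n N₁ N₂))
        upper = proj₂ (close₂ k (ℕₚ.m≤n⊔m N₁ N₂))
    in
    <-by (+-pos (<⇒0<- lower) (+-nonNeg (≤⇒0≤- (a≤b k)) (proj₁ (<⇒0<- upper))))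
      (trans (+-congʳ (+-congˡ ε≈δ+δ))
        (solve 5 (λ l m δ x y → (m :+ (δ :+ δ)) :- l := (x :- (l :- δ)) :+ ((y :- x) :+ ((m :+ δ) :- y))) refl
          l m δ (partialSum a k) (partialSum b k)))

  ↝-unique : ∀ {a l m} → a ↝ l → a ↝ m → l ≈ m
  ↝-unique a→l a→m = ≤-antisym (↝-≤ (λ _ → ≤-refl) a→l a→m) (↝-≤ (λ _ → ≤-refl) a→m a→l)

  partialSum≤limit : ∀ {a l} → (∀ k → 0# ≤ a k) → a ↝ l → ∀ k → partialSum a k ≤ l
  partialSum≤limit {a} {l} 0≤a a→l k = ≤-approx λ ε 0<ε →
    let N , close = sumsTo a→l ε 0<ε in
    ≤-<-trans (partialSum-mono {a} 0≤a (ℕₚ.m≤m⊔n k N)) (proj₂ (close (k ℕ.⊔ N) (ℕₚ.m≤n⊔m k N)))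

  term≤partialSum : ∀ {a} → (∀ k → 0# ≤ a k) → ∀ k → a k ≤ partialSum a (suc k)
  term≤partialSum         0≤a zero    = ≤-reflexive (sym (+-identityʳ _))
  term≤partialSum {a} 0≤a (suc k) = ≤-trans (term≤partialSum {a ∘ suc} (λ k → 0≤a (suc k)) k)
    (≤-respˡ-≈ (+-identityˡ _) (+-mono (0≤a 0) ≤-refl))

  -- Applied with limit `0#`, this makes every term vanish, which is how `concentrated` learns
  -- something about a single atom.
  term≤limit : ∀ {a l} → (∀ k → 0# ≤ a k) → a ↝ l → ∀ k → a k ≤ l
  term≤limit 0≤a a→l k = ≤-trans (term≤partialSum 0≤a k) (partialSum≤limit 0≤a a→l (suc k))

-- Complex vectors and matrices, and the moments of the vector state.

module ComplexField (em : ExcludedMiddle 0ℓ) (𝓡 : CompleteOrderedField) where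
  open OrderedField em 𝓡
    using ( refl; sym; trans; +-cong; +-congˡ; *-cong; -‿cong; +-identityˡ; +-identityʳ; +-comm; -‿inverseʳ
          ; ∑-nonNeg; ∑-cong; *-distribʳ-sum; ∑-block; +-nonNeg; square-nonNeg
          ; solve; _:=_; _:+_; _:*_; _:-_; :-_; :0; :1 )
  open Complex 𝓡

  ℂ-commutativeRing : CommutativeRing 0ℓ 0ℓ
  ℂ-commutativeRing = record
    { RawRing ℂ-rawRing
    ; isCommutativeRing = record
      { isRing = record
        { +-isAbelianGroup = record
          { isGroup = record
            { isMonoid = record
              { isSemigroup = record
                { isMagma = record
                  { isEquivalence = record
                    { refl  = refl , refl
                    ; sym   = λ (p , q) → sym p , sym q
                    ; trans = λ (p , q) (r , s) → trans p r , trans q s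
                    }
                  ; ∙-cong = λ (p , q) (r , s) → +-cong p r , +-cong q s
                  }
                ; assoc = λ z w v → +-assoc _ _ _ , +-assoc _ _ _
                }
              ; identity = (λ z → +-identityˡ _ , +-identityˡ _) , (λ z → +-identityʳ _ , +-identityʳ _)
              }
            ; inverse = (λ z → -‿inverseˡ _ , -‿inverseˡ _) , (λ z → -‿inverseʳ _ , -‿inverseʳ _)
            ; ⁻¹-cong = λ (p , q) → -‿cong p , -‿cong q
            }
          ; comm = λ z w → +-comm _ _ , +-comm _ _
          }
        ; *-cong = *ᶜ-cong
        ; *-assoc = λ (a +i b) (c +i d) (e +i f) →
            solve 6 (λ a b c d e f → (a :* c :- b :* d) :* e :- (a :* d :+ b :* c) :* f
                                  := a :* (c :* e :- d :* f) :- b :* (c :* f :+ d :* e)) refl a b c d e f ,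
            solve 6 (λ a b c d e f → (a :* c :- b :* d) :* f :+ (a :* d :+ b :* c) :* e
                                  := a :* (c :* f :+ d :* e) :+ b :* (c :* e :- d :* f)) refl a b c d e f
        ; *-identity = 1-*ᶜ , λ z → *ᶜ-trans (*ᶜ-comm z 1ᶜ) (1-*ᶜ z)
        ; distrib = *ᶜ-distribˡ , (λ z w v → *ᶜ-trans (*ᶜ-comm (w +ᶜ v) z) (*ᶜ-trans (*ᶜ-distribˡ z w v)
            (+-cong (proj₁ (*ᶜ-comm z w)) (proj₁ (*ᶜ-comm z v)) , +-cong (proj₂ (*ᶜ-comm z w)) (proj₂ (*ᶜ-comm z v)))))
        }
      ; *-comm = *ᶜ-comm
      }
    }
    where
    open CommutativeRing commutativeRing using (+-assoc; -‿inverseˡ)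
    *ᶜ-trans : ∀ {z w v} → z ≈ᶜ w → w ≈ᶜ v → z ≈ᶜ v
    *ᶜ-trans (p , q) (r , s) = trans p r , trans q s
    *ᶜ-cong : ∀ {z w v u} → z ≈ᶜ w → v ≈ᶜ u → z *ᶜ v ≈ᶜ w *ᶜ u
    *ᶜ-cong (p , q) (r , s) = +-cong (*-cong p r) (-‿cong (*-cong q s)) , +-cong (*-cong p s) (*-cong q r)
    *ᶜ-comm : ∀ z w → z *ᶜ w ≈ᶜ w *ᶜ z
    *ᶜ-comm (a +i b) (c +i d) =
      solve 4 (λ a b c d → a :* c :- b :* d := c :* a :- d :* b) refl a b c d ,
      solve 4 (λ a b c d → a :* d :+ b :* c := c :* b :+ d :* a) refl a b c d
    1-*ᶜ : ∀ z → 1ᶜ *ᶜ z ≈ᶜ z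
    1-*ᶜ (a +i b) = solve 2 (λ a b → :1 :* a :- :0 :* b := a) refl a b ,
                    solve 2 (λ a b → :1 :* b :+ :0 :* a := b) refl a b
    *ᶜ-distribˡ : ∀ z w v → z *ᶜ (w +ᶜ v) ≈ᶜ (z *ᶜ w) +ᶜ (z *ᶜ v)
    *ᶜ-distribˡ (a +i b) (c +i d) (e +i f) =
      solve 6 (λ a b c d e f → a :* (c :+ e) :- b :* (d :+ f) := (a :* c :- b :* d) :+ (a :* e :- b :* f)) refl a b c d e f ,
      solve 6 (λ a b c d e f → a :* (d :+ f) :+ b :* (c :+ e) := (a :* d :+ b :* c) :+ (a :* f :+ b :* e)) refl a b c d e f

  private
    module ℂRing = CommutativeRing ℂ-commutativeRing

  open CommutativeSemigroupProperties ℂRing.*-commutativeSemigroup using (xy∙z≈x∙zy)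
  open import Relation.Binary.Reasoning.Setoid ℂRing.setoid

  module ℂₛ where
    open ℂRing public
      using (refl; trans; reflexive; *-congˡ; *-congʳ; *-assoc; *-comm; *-identityˡ; *-identityʳ; zeroˡ)
    open RingSum ℂ-commutativeRing public

  conj-+ : ∀ z w → conj (z +ᶜ w) ≈ᶜ conj z +ᶜ conj w
  conj-+ (a +i b) (c +i d) = refl , solve 2 (λ b d → :- (b :+ d) := :- b :+ :- d) refl b d

  conj-* : ∀ z w → conj (z *ᶜ w) ≈ᶜ conj z *ᶜ conj w
  conj-* (a +i b) (c +i d) =
    solve 4 (λ a b c d → a :* c :- b :* d := a :* c :- (:- b) :* (:- d)) refl a b c d ,
    solve 4 (λ a b c d → :- (a :* d :+ b :* c) := a :* (:- d) :+ (:- b) :* c) refl a b c d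

  conj-involutive : ∀ z → conj (conj z) ≈ᶜ z
  conj-involutive (a +i b) = refl , solve 1 (λ b → :- (:- b) := b) refl b

  conj-∑ : ∀ {n} (f : Vector ℂ n) → conj (∑ᶜ f) ≈ᶜ ∑ᶜ (λ i → conj (f i))
  conj-∑ {zero}  f = refl , solve 0 (:- :0 := :0) refl
  conj-∑ {suc n} f = ℂₛ.trans (conj-+ (f zero) _) (+-congˡ (proj₁ (conj-∑ (f ∘ suc))) , +-congˡ (proj₂ (conj-∑ (f ∘ suc))))

  ofReal-* : ∀ x y → ofReal (x * y) ≈ᶜ ofReal x *ᶜ ofReal y
  ofReal-* x y = solve 2 (λ x y → x :* y := x :* y :- :0 :* :0) refl x y ,
                 solve 2 (λ x y → :0 := x :* :0 :+ :0 :* y) refl x y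

  ofReal-∑ : ∀ {n} (f : Vector ℝ n) → ofReal (∑ f) ≈ᶜ ∑ᶜ (λ i → ofReal (f i))
  ofReal-∑ {zero}  f = refl , refl
  ofReal-∑ {suc n} f = +-congˡ (proj₁ (ofReal-∑ (f ∘ suc))) ,
                       trans (sym (+-identityˡ 0#)) (+-congˡ (proj₂ (ofReal-∑ (f ∘ suc))))

  ∣∣²-nonNeg : ∀ z → 0# ≤ ∣ z ∣²
  ∣∣²-nonNeg (a +i b) = +-nonNeg (square-nonNeg a) (square-nonNeg b)

  -- The origin of the squared cosines: with `z` the inner product of an eigenvector with `ξ` and
  -- `x` a power of its eigenvalue, the two conjugate factors merge into a real weight. This is also
  -- why the moments are real.
  z*x*conj-z : ∀ z x → z *ᶜ ofReal x *ᶜ conj z ≈ᶜ ofReal (∣ z ∣² * x)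
  z*x*conj-z (a +i b) x =
    solve 3 (λ a b x → (a :* x :- b :* :0) :* a :- (a :* :0 :+ b :* x) :* (:- b) := (a :* a :+ b :* b) :* x) refl a b x ,
    solve 3 (λ a b x → (a :* x :- b :* :0) :* (:- b) :+ (a :* :0 :+ b :* x) :* a := :0) refl a b x

  ⟨⟩-cong : ∀ {n} {u v w : ℂ^ n} → v ≈ᵛ w → ⟨ u , v ⟩ ≈ᶜ ⟨ u , w ⟩
  ⟨⟩-cong v≈w = ℂₛ.∑-cong λ i → ℂₛ.*-congˡ (v≈w i)

  conj-⟨⟩ : ∀ {n} (u v : ℂ^ n) → conj ⟨ u , v ⟩ ≈ᶜ ⟨ v , u ⟩
  conj-⟨⟩ u v = ℂₛ.trans (conj-∑ (λ i → conj (u i) *ᶜ v i)) (ℂₛ.∑-cong λ i →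
    ℂₛ.trans (conj-* (conj (u i)) (v i)) (ℂₛ.trans (ℂₛ.*-congʳ (conj-involutive (u i))) (ℂₛ.*-comm (u i) (conj (v i)))))

  ·ᵛ-assoc : ∀ {p q r} (A : Matrix p q) (B : Matrix q r) (v : ℂ^ r) → (A · B) ·ᵛ v ≈ᵛ A ·ᵛ (B ·ᵛ v)
  ·ᵛ-assoc A B v i = begin
    ∑ᶜ (λ t → ∑ᶜ (λ s → A i s *ᶜ B s t) *ᶜ v t)   ≈⟨ ℂₛ.∑-cong (λ t → ℂₛ.*-comm _ (v t)) ⟩
    ∑ᶜ (λ t → v t *ᶜ ∑ᶜ (λ s → A i s *ᶜ B s t))   ≈⟨ ℂₛ.∑-*-∑-comm v (A i) B ⟩
    ∑ᶜ (λ s → A i s *ᶜ ∑ᶜ (λ t → v t *ᶜ B s t))   ≈⟨ ℂₛ.∑-cong (λ s → ℂₛ.*-congˡ (ℂₛ.∑-cong (λ t → ℂₛ.*-comm (v t) (B s t)))) ⟩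
    ∑ᶜ (λ s → A i s *ᶜ ∑ᶜ (λ t → B s t *ᶜ v t))   ∎

  I·ᵛ : ∀ {n} (v : ℂ^ n) → I ·ᵛ v ≈ᵛ v
  I·ᵛ v i = ℂₛ.trans (ℂₛ.∑-single i off) on
    where
    off : ∀ j → j ≢ i → I i j *ᶜ v j ≈ᶜ 0ᶜ
    off j j≢i with i ≟ j
    ... | yes i≡j = ⊥-elim (j≢i (≡.sym i≡j))
    ... | no  _   = ℂₛ.zeroˡ (v j)
    on : I i i *ᶜ v i ≈ᶜ v i
    on with i ≟ i
    ... | yes _   = ℂₛ.*-identityˡ (v i)
    ... | no  i≢i = ⊥-elim (i≢i ≡.refl)

  -- The blocks are flattened to one index `c` over all columns, with eigenvalues repeated;
  -- `resolution` is the identity `U · U ᴴ ≈ᴹ I`, read as a sum of rank-one matrices.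
  module _ {n N : ℕ} (ξ : ℂ^ n) (A : M n) (eigenvalue : Vector ℝ N) (u : Vector (ℂ^ n) N)
           (eigen : ∀ c → A ·ᵛ u c ≈ᵛ ofReal (eigenvalue c) ∙ᵛ u c)
           (resolution : ∀ r t → ∑ᶜ (λ c → u c r *ᶜ conj (u c t)) ≈ᶜ I r t)
           where

    private
      coefficient : ℕ → Vector ℂ N
      coefficient k c = ⟨ u c , ξ ⟩ *ᶜ ofReal (eigenvalue c ^ k)

    -- For exponent zero, applying `resolution` to `ξ` expands it in the columns. Each further
    -- factor `A` multiplies the coefficient of `u c` by its eigenvalue.
    power-expansion : ∀ k → (A ^ᴹ k) ·ᵛ ξ ≈ᵛ lincomb (coefficient k) u
    power-expansion zero r = begin
      ∑ᶜ (λ t → I r t *ᶜ ξ t)                               ≈⟨ ℂₛ.∑-cong (λ t → ℂₛ.*-congʳ (resolution r t)) ⟨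
      ∑ᶜ (λ t → ∑ᶜ (λ c → u c r *ᶜ conj (u c t)) *ᶜ ξ t)    ≈⟨ ·ᵛ-assoc (λ r c → u c r) (λ c t → conj (u c t)) ξ r ⟩
      ∑ᶜ (λ c → u c r *ᶜ ⟨ u c , ξ ⟩)                       ≈⟨ ℂₛ.∑-cong (λ c → ℂₛ.*-comm (u c r) ⟨ u c , ξ ⟩) ⟩
      ∑ᶜ (λ c → ⟨ u c , ξ ⟩ *ᶜ u c r)                       ≈⟨ ℂₛ.∑-cong (λ c → ℂₛ.*-congʳ (ℂₛ.*-identityʳ ⟨ u c , ξ ⟩)) ⟨
      ∑ᶜ (λ c → coefficient 0 c *ᶜ u c r)                   ∎
    power-expansion (suc k) r = begin
      ((A · (A ^ᴹ k)) ·ᵛ ξ) r                               ≈⟨ ·ᵛ-assoc A (A ^ᴹ k) ξ r ⟩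
      ∑ᶜ (λ s → A r s *ᶜ ((A ^ᴹ k) ·ᵛ ξ) s)                 ≈⟨ ℂₛ.∑-cong (λ s → ℂₛ.*-congˡ (power-expansion k s)) ⟩
      ∑ᶜ (λ s → A r s *ᶜ lincomb (coefficient k) u s)       ≈⟨ ℂₛ.∑-*-∑-comm (A r) (coefficient k) u ⟩
      ∑ᶜ (λ c → coefficient k c *ᶜ (A ·ᵛ u c) r)            ≈⟨ ℂₛ.∑-cong (λ c → ℂₛ.*-congˡ (eigen c r)) ⟩
      ∑ᶜ (λ c → coefficient k c *ᶜ (ofReal (eigenvalue c) *ᶜ u c r)) ≈⟨ ℂₛ.∑-cong next ⟩
      ∑ᶜ (λ c → coefficient (suc k) c *ᶜ u c r)             ∎
      where
      next : ∀ c → coefficient k c *ᶜ (ofReal (eigenvalue c) *ᶜ u c r) ≈ᶜ coefficient (suc k) c *ᶜ u c r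
      next c = begin
        coefficient k c *ᶜ (ofReal (eigenvalue c) *ᶜ u c r)
          ≈⟨ ℂₛ.*-assoc (coefficient k c) (ofReal (eigenvalue c)) (u c r) ⟨
        coefficient k c *ᶜ ofReal (eigenvalue c) *ᶜ u c r
          ≈⟨ ℂₛ.*-congʳ (xy∙z≈x∙zy ⟨ u c , ξ ⟩ (ofReal (eigenvalue c ^ k)) (ofReal (eigenvalue c))) ⟩
        ⟨ u c , ξ ⟩ *ᶜ (ofReal (eigenvalue c) *ᶜ ofReal (eigenvalue c ^ k)) *ᶜ u c r
          ≈⟨ ℂₛ.*-congʳ (ℂₛ.*-congˡ {⟨ u c , ξ ⟩} (ofReal-* (eigenvalue c) (eigenvalue c ^ k))) ⟨
        coefficient (suc k) c *ᶜ u c r ∎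

    vectorState-power : ∀ k → vectorState ξ (A ^ᴹ k) ≈ᶜ ofReal (∑ (λ c → ∣ ⟨ u c , ξ ⟩ ∣² * eigenvalue c ^ k))
    vectorState-power k = begin
      ⟨ ξ , (A ^ᴹ k) ·ᵛ ξ ⟩                              ≈⟨ ⟨⟩-cong {u = ξ} (power-expansion k) ⟩
      ⟨ ξ , lincomb (coefficient k) u ⟩                  ≈⟨ ℂₛ.∑-*-∑-comm (λ i → conj (ξ i)) (coefficient k) u ⟩
      ∑ᶜ (λ c → coefficient k c *ᶜ ⟨ ξ , u c ⟩)          ≈⟨ ℂₛ.∑-cong (λ c → ℂₛ.*-congˡ {coefficient k c} (conj-⟨⟩ (u c) ξ)) ⟨
      ∑ᶜ (λ c → coefficient k c *ᶜ conj ⟨ u c , ξ ⟩)     ≈⟨ ℂₛ.∑-cong (λ c → z*x*conj-z ⟨ u c , ξ ⟩ (eigenvalue c ^ k)) ⟩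
      ∑ᶜ (λ c → ofReal (∣ ⟨ u c , ξ ⟩ ∣² * eigenvalue c ^ k))  ≈⟨ ofReal-∑ (λ c → ∣ ⟨ u c , ξ ⟩ ∣² * eigenvalue c ^ k) ⟨
      ofReal (∑ (λ c → ∣ ⟨ u c , ξ ⟩ ∣² * eigenvalue c ^ k))   ∎

  -- Both `hcat` and `block` branch on the same `splitAt`, so one case distinction reduces both
  -- sides.
  hcat-block : ∀ {p s} (m : Vector ℕ s) (V : ∀ i → Matrix p (m i)) (r : Fin p) (c : Fin (∑ℕ m)) →
               hcat m V r c ≡ V (proj₁ (block m c)) r (proj₂ (block m c))
  hcat-block {s = suc s} m V r c with splitAt (m zero) c
  ... | inj₁ j  = ≡.refl
  ... | inj₂ c′ = hcat-block (m ∘ suc) (λ i → V (suc i)) r c′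

  weight : ∀ {n s} → ℂ^ n → (m : Vector ℕ s) → (∀ i → Matrix n (m i)) → Vector ℝ s
  weight ξ m Us i = ∑ (λ j → ∣ cosAngle (col (Us i) j) ξ ∣²)

  weight-nonNeg : ∀ {n s} (ξ : ℂ^ n) (m : Vector ℕ s) (Us : ∀ i → Matrix n (m i)) i → 0# ≤ weight ξ m Us i
  weight-nonNeg ξ m Us i = ∑-nonNeg (λ j → ∣∣²-nonNeg (cosAngle (col (Us i) j) ξ))

  vectorState-moments :
    ∀ {n s} (ξ : ℂ^ n) (A : M n) (eigval : Vector ℝ s) (mult : Vector ℕ s) (dim : ∑ℕ mult ≡ n)
    (Us : ∀ i → Matrix n (mult i)) →
    let U = subst (Matrix n) dim (hcat mult Us) in
    (∀ i j → A ·ᵛ col (Us i) j ≈ᵛ ofReal (eigval i) ∙ᵛ col (Us i) j) → U · U ᴴ ≈ᴹ I →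
    ∀ k → vectorState ξ (A ^ᴹ k) ≈ᶜ ofReal (∑ (λ i → weight ξ mult Us i * eigval i ^ k))
  -- Matching `dim` with `≡.refl` removes the `subst` from `U`.
  vectorState-moments ξ A eigval mult ≡.refl Us eigen UUᴴ≈I k = ℂₛ.trans
    (vectorState-power ξ A (λ c → eigval (proj₁ (block mult c)))
      (λ c → col (Us (proj₁ (block mult c))) (proj₂ (block mult c)))
      (λ c → eigen _ _) resolution k)
    -- The columns are regrouped by eigenvalue, whose power then factors out of each block and
    -- leaves the weight.
    (trans (∑-block mult (λ i j → ∣ ⟨ col (Us i) j , ξ ⟩ ∣² * eigval i ^ k))
           (∑-cong λ i → sym (*-distribʳ-sum (eigval i ^ k) (λ j → ∣ ⟨ col (Us i) j , ξ ⟩ ∣²))) , refl)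
    where
    resolution : ∀ r t → ∑ᶜ (λ c → let i , j = block mult c in Us i r j *ᶜ conj (Us i t j)) ≈ᶜ I r t
    resolution r t = ℂₛ.trans
      (ℂₛ.∑-cong λ c → ℂₛ.reflexive (≡.cong₂ (λ z w → z *ᶜ conj w)
        (≡.sym (hcat-block mult Us r c)) (≡.sym (hcat-block mult Us t c))))
      (UUᴴ≈I r t)

-- Borel codes and the measurability of powers.

module BorelSets (em : ExcludedMiddle 0ℓ) (𝓡 : CompleteOrderedField) where
  open OrderedField em 𝓡
  open Measure 𝓡

  stable : ∀ {P : Set} → ¬ ¬ P → P
  stable {P} ¬¬p with em {P}
  ... | yes p = p
  ... | no ¬p = ⊥-elim (¬¬p ¬p)

  ∈-resp-≈ : ∀ B {x y} → x ≈ y → x ∈ ⟦ B ⟧ → y ∈ ⟦ B ⟧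
  ∈-resp-≈ ⦅ a ، b ⦆ x≈y (a<x , x<b) = <-respʳ-≈ x≈y a<x , <-respˡ-≈ x≈y x<b
  ∈-resp-≈ (∁ B)     x≈y x∉B         = x∉B ∘ ∈-resp-≈ B (sym x≈y)
  ∈-resp-≈ (⋃ B)     x≈y (k , x∈Bₖ)  = k , ∈-resp-≈ (B k) x≈y x∈Bₖ

  -- The same interval as in `univ`, so that `∉∅` itself proves membership in `univ`.
  ∅ : Borel
  ∅ = ⦅ 0# ، 0# ⦆

  ∉∅ : ∀ {x} → x ∉ ⟦ ∅ ⟧
  ∉∅ (0<x , x<0) = <⇒≱ 0<x (proj₁ x<0)

  infixr 6 _∪_
  infixr 7 _∩_

  pair : Borel → Borel → ℕ → Borel
  pair A B zero    = A
  pair A B (suc _) = B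

  _∪_ _∩_ : Borel → Borel → Borel
  A ∪ B = ⋃ (pair A B)
  A ∩ B = ∁ (∁ A ∪ ∁ B)

  ∈-∪⁻ : ∀ A B {x} → x ∈ ⟦ A ∪ B ⟧ → x ∈ ⟦ A ⟧ ⊎ x ∈ ⟦ B ⟧
  ∈-∪⁻ A B (zero  , x∈A) = inj₁ x∈A
  ∈-∪⁻ A B (suc _ , x∈B) = inj₂ x∈B

  ∈-∩⁺ : ∀ A B {x} → x ∈ ⟦ A ⟧ → x ∈ ⟦ B ⟧ → x ∈ ⟦ A ∩ B ⟧
  ∈-∩⁺ A B x∈A x∈B = [ (λ x∉A → x∉A x∈A) , (λ x∉B → x∉B x∈B) ]′ ∘ ∈-∪⁻ (∁ A) (∁ B)

  ∈-∩⁻ : ∀ A B {x} → x ∈ ⟦ A ∩ B ⟧ → x ∈ ⟦ A ⟧ × x ∈ ⟦ B ⟧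
  ∈-∩⁻ A B x∈A∩B = stable (λ x∉A → x∈A∩B (0 , x∉A)) , stable (λ x∉B → x∈A∩B (1 , x∉B))

  -- Codes start from bounded open intervals: deleting from a bounded window around `a` its parts
  -- left and right of `a` leaves that point, with no limit process.
  singleton : ℝ → Borel
  singleton a = ⦅ a - 1# ، a + 1# ⦆ ∩ ∁ (⦅ a - 1# ، a ⦆ ∪ ⦅ a ، a + 1# ⦆)

  ∈-singleton⁺ : ∀ {x a} → x ≈ a → x ∈ ⟦ singleton a ⟧
  ∈-singleton⁺ {x} {a} x≈a = ∈-resp-≈ (singleton a) (sym x≈a)
    (∈-∩⁺ ⦅ a - 1# ، a + 1# ⦆ (∁ (⦅ a - 1# ، a ⦆ ∪ ⦅ a ، a + 1# ⦆)) (x-ε<x 0<1 , x<x+ε 0<1)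
      ([ (λ (_ , a<a) → <-irrefl a<a) , (λ (a<a , _) → <-irrefl a<a) ]′ ∘ ∈-∪⁻ ⦅ a - 1# ، a ⦆ ⦅ a ، a + 1# ⦆))

  ∈-singleton⁻ : ∀ {x a} → x ∈ ⟦ singleton a ⟧ → x ≈ a
  ∈-singleton⁻ {x} {a} x∈ =
    let (a-1<x , x<a+1) , x∉ = ∈-∩⁻ ⦅ a - 1# ، a + 1# ⦆ (∁ (⦅ a - 1# ، a ⦆ ∪ ⦅ a ، a + 1# ⦆)) x∈ in
    ≤-antisym (≮⇒≥ λ a<x → x∉ (1 , a<x , x<a+1)) (≮⇒≥ λ x<a → x∉ (0 , a-1<x , x<a))

  open RawMonoidDefinitions (CommutativeMonoid.rawMonoid +-commutativeMonoid) using () renaming (_×_ to _•_)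

  -- If the multiples of `1#` were bounded, with supremum `s`, then `s - 1#` would bound them as
  -- well, since the successor of each is at most `s`. The bound lets `below` and `above` exhaust
  -- open rays by bounded intervals.
  archimedean : ∀ x → Σ[ n ∈ ℕ ] x < n • 1#
  archimedean x = stable λ noBound →
    let bounded : UpperBound (λ y → Σ[ n ∈ ℕ ] y ≈ n • 1#) x
        bounded = λ y (n , y≈n) → ≤-respˡ-≈ (sym y≈n) (≮⇒≥ λ x<n → noBound (n , x<n))
        s , isBound , isLeast = complete _ (0# , 0 , refl) (x , bounded)
    in <⇒≱ (x-ε<x 0<1) (isLeast (s - 1#) λ y (n , y≈n) → ≤-respˡ-≈ (sym y≈n)
         (≤-by (≤⇒0≤- (isBound (1# + n • 1#) (suc n , refl)))
           (solve 2 (λ s y → (s :- :1) :- y := s :- (:1 :+ y)) refl s (n • 1#))))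

  below above : ℝ → Borel
  below a = ⋃ λ n → ⦅ a - n • 1# ، a ⦆
  above a = ⋃ λ n → ⦅ a ، a + n • 1# ⦆

  ∈-below : ∀ {a x} → x < a → x ∈ ⟦ below a ⟧
  ∈-below {a} {x} x<a = let n , a-x<n = archimedean (a - x) in
    n , <-by (<⇒0<- a-x<n) (solve 3 (λ a x n → x :- (a :- n) := n :- (a :- x)) refl a x (n • 1#)) , x<a

  ∈-above : ∀ {a x} → a < x → x ∈ ⟦ above a ⟧
  ∈-above {a} {x} a<x = let n , x-a<n = archimedean (x - a) in
    n , a<x , <-by (<⇒0<- x-a<n) (solve 3 (λ a x n → (a :+ n) :- x := n :- (x :- a)) refl a x (n • 1#))

  IsBorel : Pred ℝ 0ℓ → Set
  IsBorel P = Σ[ B ∈ Borel ] ∀ x → (x ∈ ⟦ B ⟧ ⇔ P x)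

  -- Such a set is empty, the whole line, or a ray ending at its supremum `s`; the ray is closed or
  -- open according to whether `s` belongs to it.
  lowerSet-isBorel : (P : Pred ℝ 0ℓ) → (∀ {x y} → x ≤ y → P y → P x) → IsBorel P
  lowerSet-isBorel P lower with em {∃ P} | em {∃ (UpperBound P)}
  ... | no ¬∃P | _ = ∅ , λ x → mk⇔ (⊥-elim ∘ ∉∅) (λ Px → ⊥-elim (¬∃P (x , Px)))
  ... | yes _ | no ¬bounded = univ , λ x → mk⇔ (λ _ → everything x) (λ _ → ∉∅)
    where
    everything : ∀ x → P x
    everything x = stable λ ¬Px → ¬bounded (x , λ y Py → ≮⇒≥ λ x<y → ¬Px (lower (proj₁ x<y) Py))
  ... | yes ∃P | yes bounded with complete P ∃P bounded
  ...   | s , isBound , isLeast with em {P s}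
  ...     | yes Ps = ∁ above s , λ x → mk⇔
    (λ x≯s → lower (≮⇒≥ (x≯s ∘ ∈-above)) Ps)
    (λ Px (_ , s<x , _) → <⇒≱ s<x (isBound x Px))
  ...     | no ¬Ps = below s , λ x → mk⇔
    (λ (_ , _ , x<s) → stable λ ¬Px → <⇒≱ x<s (isLeast x λ y Py → ≮⇒≥ λ x<y → ¬Px (lower (proj₁ x<y) Py)))
    (λ Px → ∈-below (isBound x Px , λ x≈s → ¬Ps (lower (≤-reflexive (sym x≈s)) Px)))

  -- A convex set is the intersection of its downward closure `D` and its upward closure; the latter
  -- is coded as `∁ L`, because its complement is again a lower set.
  convex-isBorel : (P : Pred ℝ 0ℓ) → (∀ {a b x} → P a → P b → a ≤ x → x ≤ b → P x) → IsBorel P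
  convex-isBorel P convex =
    let D , D⇔ = lowerSet-isBorel (λ x → Σ[ y ∈ ℝ ] P y × x ≤ y) (λ x≤y (z , Pz , y≤z) → z , Pz , ≤-trans x≤y y≤z)
        L , L⇔ = lowerSet-isBorel (λ x → ¬ (Σ[ y ∈ ℝ ] P y × y ≤ x)) (λ x≤y ¬y (z , Pz , z≤x) → ¬y (z , Pz , ≤-trans z≤x x≤y))
    in D ∩ ∁ L , λ x → mk⇔
      (λ x∈ → let x∈D , x∉L = ∈-∩⁻ D (∁ L) x∈
                  b , Pb , x≤b = Equivalence.to (D⇔ x) x∈D
                  a , Pa , a≤x = stable (x∉L ∘ Equivalence.from (L⇔ x))
              in convex Pa Pb a≤x x≤b)
      (λ Px → ∈-∩⁺ D (∁ L) (Equivalence.from (D⇔ x) (x , Px , ≤-refl)) λ x∈L → Equivalence.to (L⇔ x) x∈L (x , Px , ≤-refl))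

  ^-cong : ∀ k {x y} → x ≈ y → x ^ k ≈ y ^ k
  ^-cong zero    x≈y = refl
  ^-cong (suc k) x≈y = *-cong x≈y (^-cong k x≈y)

  ^-nonNeg : ∀ k {x} → 0# ≤ x → 0# ≤ x ^ k
  ^-nonNeg zero    0≤x = 0≤1
  ^-nonNeg (suc k) 0≤x = *-nonNeg _ _ 0≤x (^-nonNeg k 0≤x)

  ^-mono : ∀ k {x y} → 0# ≤ x → x ≤ y → x ^ k ≤ y ^ k
  ^-mono zero    0≤x x≤y = ≤-refl
  ^-mono (suc k) {x} {y} 0≤x x≤y =
    ≤-by (+-nonNeg (*-nonNeg _ _ 0≤x (≤⇒0≤- (^-mono k 0≤x x≤y))) (*-nonNeg _ _ (≤⇒0≤- x≤y) (^-nonNeg k (≤-trans 0≤x x≤y))))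
      (solve 4 (λ x y p q → y :* q :- x :* p := x :* (q :- p) :+ (y :- x) :* q) refl x y (x ^ k) (y ^ k))

  -- The two alternatives are those of odd and even exponents.
  ^-nonPos : ∀ k {a x} → a ≤ x → x ≤ 0# → (a ^ k ≤ x ^ k × x ^ k ≤ 0#) ⊎ (0# ≤ x ^ k × x ^ k ≤ a ^ k)
  ^-nonPos zero    a≤x x≤0 = inj₂ (0≤1 , ≤-refl)
  ^-nonPos (suc k) {a} {x} a≤x x≤0 with ^-nonPos k a≤x x≤0
  ... | inj₁ (aᵏ≤xᵏ , xᵏ≤0) = inj₂
    ( ≤-by (*-nonNeg _ _ (≤0⇒0≤- x≤0) (≤0⇒0≤- xᵏ≤0)) (solve 2 (λ x p → x :* p :- :0 := (:- x) :* (:- p)) refl x (x ^ k))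
    , ≤-by (+-nonNeg (*-nonNeg _ _ (≤0⇒0≤- (≤-trans a≤x x≤0)) (≤⇒0≤- aᵏ≤xᵏ)) (*-nonNeg _ _ (≤⇒0≤- a≤x) (≤0⇒0≤- xᵏ≤0)))
        (solve 4 (λ a x p q → a :* p :- x :* q := (:- a) :* (q :- p) :+ (x :- a) :* (:- q)) refl a x (a ^ k) (x ^ k)))
  ... | inj₂ (0≤xᵏ , xᵏ≤aᵏ) = inj₁
    ( ≤-by (+-nonNeg (*-nonNeg _ _ (≤0⇒0≤- (≤-trans a≤x x≤0)) (≤⇒0≤- xᵏ≤aᵏ)) (*-nonNeg _ _ (≤⇒0≤- a≤x) 0≤xᵏ))
        (solve 4 (λ a x p q → x :* q :- a :* p := (:- a) :* (p :- q) :+ (x :- a) :* q) refl a x (a ^ k) (x ^ k))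
    , ≤-by (*-nonNeg _ _ (≤0⇒0≤- x≤0) 0≤xᵏ) (solve 2 (λ x p → :0 :- x :* p := (:- x) :* p) refl x (x ^ k)))

  -- Powers are quasiconvex, so their strict sublevel sets are convex, hence Borel; measurability
  -- follows without any appeal to continuity.
  ^-between : ∀ k {a b x} → a ≤ x → x ≤ b → x ^ k ≤ a ^ k ⊎ x ^ k ≤ b ^ k
  ^-between k {a} {b} {x} a≤x x≤b with ≤-total 0# x
  ... | inj₁ 0≤x = inj₂ (^-mono k 0≤x x≤b)
  ... | inj₂ x≤0 with ^-nonPos k a≤x x≤0 | ≤-total 0# b
  ...   | inj₂ (_ , xᵏ≤aᵏ) | _        = inj₁ xᵏ≤aᵏ
  ...   | inj₁ (_ , xᵏ≤0)  | inj₁ 0≤b = inj₂ (≤-trans xᵏ≤0 (^-nonNeg k 0≤b))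
  ...   | inj₁ (_ , xᵏ≤0)  | inj₂ b≤0 with ^-nonPos k x≤b b≤0
  ...     | inj₁ (xᵏ≤bᵏ , _) = inj₂ xᵏ≤bᵏ
  ...     | inj₂ (0≤bᵏ , _)  = inj₂ (≤-trans xᵏ≤0 0≤bᵏ)

  ^-isMeasurable : ∀ k → IsMeasurable (_^ k)
  ^-isMeasurable k c = convex-isBorel (λ x → x ^ k < c) λ aᵏ<c bᵏ<c a≤x x≤b →
    [ (λ xᵏ≤aᵏ → ≤-<-trans xᵏ≤aᵏ aᵏ<c) , (λ xᵏ≤bᵏ → ≤-<-trans xᵏ≤bᵏ bᵏ<c) ]′ (^-between k a≤x x≤b)

-- Finite atomic measures and their integrals.

module Integration (em : ExcludedMiddle 0ℓ) (𝓡 : CompleteOrderedField) where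
  open OrderedField em 𝓡
  open Series em 𝓡
  open BorelSets em 𝓡
  open Measure 𝓡
  open NaturalMax totalOrder using (⊔-cong; x≤y⊔x; x≤y⇒x⊔y≈y; x≤y⇒y⊔x≈y)
  open import Relation.Binary.Reasoning.Setoid setoid

  δ : ℝ → Borel → ℝ
  δ = Dirac em

  δ-∈ : ∀ {a} B → a ∈ ⟦ B ⟧ → δ a B ≈ 1#
  δ-∈ {a} B a∈B with em {a ∈ ⟦ B ⟧}
  ... | yes _   = refl
  ... | no  a∉B = ⊥-elim (a∉B a∈B)

  δ-∉ : ∀ {a} B → a ∉ ⟦ B ⟧ → δ a B ≈ 0#
  δ-∉ {a} B a∉B with em {a ∈ ⟦ B ⟧}
  ... | yes a∈B = ⊥-elim (a∉B a∈B)
  ... | no  _   = refl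

  δ-nonNeg : ∀ a B → 0# ≤ δ a B
  δ-nonNeg a B with em {a ∈ ⟦ B ⟧}
  ... | yes _ = 0≤1
  ... | no  _ = ≤-refl

  δ-cong : ∀ {a b} B C → a ≈ b → ⟦ B ⟧ ≐ ⟦ C ⟧ → δ a B ≈ δ b C
  δ-cong {a} {b} B C a≈b (B⊆C , C⊆B) with em {a ∈ ⟦ B ⟧}
  ... | yes a∈B = sym (δ-∈ C (∈-resp-≈ C a≈b (B⊆C a∈B)))
  ... | no  a∉B = sym (δ-∉ C (a∉B ∘ C⊆B ∘ ∈-resp-≈ C (sym a≈b)))

  Disjoint : ∀ {K : Set} → (K → Borel) → Set
  Disjoint B = ∀ i j → i ≢ j → ⟦ B i ⟧ ⊥ ⟦ B j ⟧

  δ-⋃ : ∀ a (B : ℕ → Borel) → Disjoint B → (λ k → δ a (B k)) ↝ δ a (⋃ B)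
  δ-⋃ a B disjoint with em {a ∈ ⟦ ⋃ B ⟧}
  ... | yes (j , a∈Bⱼ) = ↝-cong (λ _ → refl) (δ-∈ (B j) a∈Bⱼ)
                           (↝-single j λ k k≢j → δ-∉ (B k) λ a∈Bₖ → disjoint k j k≢j (a∈Bₖ , a∈Bⱼ))
  ... | no  a∉⋃        = ↝-0 λ k → δ-∉ (B k) λ a∈Bₖ → a∉⋃ (k , a∈Bₖ)

  -- The sum is the value at `x` of the simple function behind a lower sum. By disjointness at most
  -- one term survives, and off all the `B i` the value is zero, whence the condition `0# ≤ f x`. It
  -- turns bounds on sets into bounds at atoms.
  simpleFunction-≤ : ∀ {p} (c : Vector ℝ p) (B : Vector Borel p) (f : ℝ → ℝ) → Disjoint B →
                     (∀ i x → x ∈ ⟦ B i ⟧ → c i ≤ f x) → ∀ x → 0# ≤ f x → ∑ (λ i → c i * δ x (B i)) ≤ f x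
  simpleFunction-≤ c B f disjoint c≤f x 0≤fx with em {Σ[ i ∈ _ ] x ∈ ⟦ B i ⟧}
  ... | yes (i , x∈Bᵢ) = ≤-respˡ-≈ (sym (begin
    ∑ (λ j → c j * δ x (B j))   ≈⟨ ∑-single i (λ j j≢i → trans (*-congˡ (δ-∉ (B j) λ x∈Bⱼ → disjoint j i j≢i (x∈Bⱼ , x∈Bᵢ))) (zeroʳ (c j))) ⟩
    c i * δ x (B i)             ≈⟨ *-congˡ (δ-∈ (B i) x∈Bᵢ) ⟩
    c i * 1#                    ≈⟨ *-identityʳ (c i) ⟩
    c i                         ∎)) (c≤f i x x∈Bᵢ)
  ... | no  x∉B = ≤-respˡ-≈ (sym (∑-zero λ i → trans (*-congˡ (δ-∉ (B i) λ x∈Bᵢ → x∉B (i , x∈Bᵢ))) (zeroʳ (c i)))) 0≤fx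

  ⊔0-nonNeg : ∀ x → 0# ≤ x ⊔ 0#
  ⊔0-nonNeg x = x≤y⊔x x 0#

  ⊔0-cong : ∀ {x y} → x ≈ y → x ⊔ 0# ≈ y ⊔ 0#
  ⊔0-cong x≈y = ⊔-cong x≈y refl

  positivePart-negativePart : ∀ x → (x ⊔ 0#) - ((- x) ⊔ 0#) ≈ x
  positivePart-negativePart x = [ nonNeg , nonPos ]′ (≤-total 0# x)
    where
    nonNeg : 0# ≤ x → (x ⊔ 0#) - ((- x) ⊔ 0#) ≈ x
    nonNeg 0≤x = trans (+-cong (x≤y⇒y⊔x≈y 0≤x) (-‿cong (x≤y⇒x⊔y≈y -x≤0))) (solve 1 (λ x → x :- :0 := x) refl x)
      where
      -x≤0 : - x ≤ 0#
      -x≤0 = ≤-by 0≤x (solve 1 (λ x → :0 :- (:- x) := x) refl x)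
    nonPos : x ≤ 0# → (x ⊔ 0#) - ((- x) ⊔ 0#) ≈ x
    nonPos x≤0 = trans (+-cong (x≤y⇒x⊔y≈y x≤0) (-‿cong (x≤y⇒y⊔x≈y (≤0⇒0≤- x≤0))))
                   (solve 1 (λ x → :0 :- (:- x) := x) refl x)

  extend : ∀ {A : Set} {n} → Vector A n → A → ℕ → A
  extend {n = zero}  v d k       = d
  extend {n = suc n} v d zero    = v zero
  extend {n = suc n} v d (suc k) = extend (v ∘ suc) d k

  extend-toℕ : ∀ {A : Set} {n} (v : Vector A n) (d : A) i → extend v d (toℕ i) ≡ v i
  extend-toℕ v d zero    = ≡.refl
  extend-toℕ v d (suc i) = extend-toℕ (v ∘ suc) d i

  module FiniteAtomic {s} (a : Vector ℝ s) (a-injective : Injective _≡_ _≈_ a)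
                      (ω : Vector ℝ s) (ω-nonNeg : ∀ i → 0# ≤ ω i) (∑ω≈1 : ∑ ω ≈ 1#) where

    measure : ProbabilityMeasure
    measure = record
      { mass        = λ B → ∑ (λ i → ω i * δ (a i) B)
      ; mass-cong   = λ B C B≐C → ∑-cong {s} λ i → *-congˡ {ω i} (δ-cong B C refl B≐C)
      ; mass-nonNeg = λ B → ∑-nonNeg λ i → *-nonNeg _ _ (ω-nonNeg i) (δ-nonNeg (a i) B)
      ; mass-univ   = trans (∑-cong λ i → trans (*-congˡ (δ-∈ univ ∉∅)) (*-identityʳ (ω i))) ∑ω≈1
      ; mass-⋃      = λ B disjoint → sumsTo (↝-∑ λ i → ↝-* (ω i) (δ-⋃ (a i) B disjoint))
      }

    isDiscrete : IsDiscrete measure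
    -- Padding the finite list by `0#` adds at most one point to `S`, which stays countable and
    -- still contains every atom.
    isDiscrete = S , (extend a 0# , λ x (k , x∈) → k , ∈-singleton⁻ x∈) ,
      ∑-zero λ i → trans (*-congˡ (δ-∉ (∁ S) λ aᵢ∉S → aᵢ∉S (toℕ i , ∈-singleton⁺ (reflexive (≡.sym (extend-toℕ a 0# i))))))
                         (zeroʳ (ω i))
      where
      S : Borel
      S = ⋃ λ k → singleton (extend a 0# k)

    mass-singleton : ∀ i → mass measure (singleton (a i)) ≈ ω i
    mass-singleton i = begin
      ∑ (λ j → ω j * δ (a j) (singleton (a i)))   ≈⟨ ∑-single i (λ j j≢i → trans (*-congˡ (δ-∉ (singleton (a i)) λ aⱼ∈ →
                                                       j≢i (a-injective (∈-singleton⁻ aⱼ∈)))) (zeroʳ (ω j))) ⟩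
      ω i * δ (a i) (singleton (a i))             ≈⟨ *-congˡ (δ-∈ (singleton (a i)) (∈-singleton⁺ refl)) ⟩
      ω i * 1#                                    ≈⟨ *-identityʳ (ω i) ⟩
      ω i                                         ∎

    -- The supremum is a maximum: the simple function with value `f (a i)` on the singleton of `a i`
    -- attains it, these singletons being disjoint because `a` is injective.
    lowerSum-sup : (f : ℝ → ℝ) → (∀ {x y} → x ≈ y → f x ≈ f y) → (∀ x → 0# ≤ f x) →
                   IsSup (IsLowerSum measure f) (∑ (λ i → ω i * f (a i)))
    lowerSum-sup f f-cong 0≤f = bound , λ u u-bound → u-bound _ attained
      where
      bound : UpperBound (IsLowerSum measure f) (∑ (λ i → ω i * f (a i)))
      bound t (p , c , B , _ , disjoint , c≤f , t≈) = ≤-respˡ-≈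
        (sym (trans t≈ (∑-*-∑-comm c ω (λ j i → δ (a j) (B i)))))
        (∑-mono λ j → *-monoˡ (ω-nonNeg j) (simpleFunction-≤ c B f disjoint c≤f (a j) (0≤f (a j))))

      attained : IsLowerSum measure f (∑ (λ i → ω i * f (a i)))
      attained = s , (λ i → f (a i)) , (λ i → singleton (a i)) , (λ i → 0≤f (a i)) ,
        (λ i j i≢j (x∈ , x∈′) → i≢j (a-injective (trans (sym (∈-singleton⁻ x∈)) (∈-singleton⁻ x∈′)))) ,
        (λ i x x∈ → ≤-reflexive (f-cong (sym (∈-singleton⁻ x∈)))) ,
        ∑-cong λ i → trans (*-comm (ω i) (f (a i))) (*-congˡ (sym (mass-singleton i)))

    hasIntegral : (f : ℝ → ℝ) → (∀ {x y} → x ≈ y → f x ≈ f y) → IsMeasurable f →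
                  HasIntegral measure f (∑ (λ i → ω i * f (a i)))
    hasIntegral f f-cong measurable = measurable , _ , _ ,
      lowerSum-sup (λ x → f x ⊔ 0#) (λ x≈y → ⊔0-cong (f-cong x≈y)) (λ x → ⊔0-nonNeg (f x)) ,
      lowerSum-sup (λ x → (- f x) ⊔ 0#) (λ x≈y → ⊔0-cong (-‿cong (f-cong x≈y))) (λ x → ⊔0-nonNeg (- f x)) ,
      (begin
        ∑ (λ i → ω i * f (a i))
          ≈⟨ ∑-cong (λ i → *-congˡ (positivePart-negativePart (f (a i)))) ⟨
        ∑ (λ i → ω i * ((f (a i) ⊔ 0#) - ((- f (a i)) ⊔ 0#)))
          ≈⟨ ∑-cong (λ i → solve 3 (λ w p q → w :* (p :- q) := w :* p :+ (:- (w :* q))) refl (ω i) (f (a i) ⊔ 0#) ((- f (a i)) ⊔ 0#)) ⟩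
        ∑ (λ i → ω i * (f (a i) ⊔ 0#) + - (ω i * ((- f (a i)) ⊔ 0#)))
          ≈⟨ ∑-distrib-+ (λ i → ω i * (f (a i) ⊔ 0#)) (λ i → - (ω i * ((- f (a i)) ⊔ 0#))) ⟩
        ∑ (λ i → ω i * (f (a i) ⊔ 0#)) + ∑ (λ i → - (ω i * ((- f (a i)) ⊔ 0#)))
          ≈⟨ +-congˡ (∑-neg (λ i → ω i * ((- f (a i)) ⊔ 0#))) ⟩
        ∑ (λ i → ω i * (f (a i) ⊔ 0#)) - ∑ (λ i → ω i * ((- f (a i)) ⊔ 0#)) ∎)

-- Discrete measures as series over their atoms.

module DiscreteMeasures (em : ExcludedMiddle 0ℓ) (𝓡 : CompleteOrderedField) where
  open OrderedField em 𝓡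
  open Series em 𝓡
  open BorelSets em 𝓡
  open Integration em 𝓡
  open Measure 𝓡
  open import Relation.Binary.Reasoning.Setoid setoid

  module _ (ν : ProbabilityMeasure) where

    -- The empty set is a disjoint union of copies of itself, so the constant series of its mass `m`
    -- sums to `m`. Dropping the first term leaves the same series but lowers the sum to `m - m`.
    mass-∅ : mass ν ∅ ≈ 0#
    mass-∅ = begin
      mass ν ∅                ≈⟨ ↝-unique (↝-tail constant) constant ⟨
      mass ν ∅ - mass ν ∅     ≈⟨ -‿inverseʳ (mass ν ∅) ⟩
      0#                      ∎
      where
      constant : (λ _ → mass ν ∅) ↝ mass ν ∅
      constant = ↝-cong (λ _ → refl) (mass-cong ν (⋃ λ _ → ∅) ∅ (proj₂ , λ x∈∅ → 0 , x∈∅))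
        (tends (mass-⋃ ν (λ _ → ∅) λ _ _ _ (x∈∅ , _) → ∉∅ x∈∅))

    -- The sequence `pair A B` behind the union repeats `B` and need not be pairwise disjoint;
    -- countable additivity is applied to a sequence padded by `∅` instead.
    mass-∪ : ∀ A B → ⟦ A ⟧ ⊥ ⟦ B ⟧ → mass ν (A ∪ B) ≈ mass ν A + mass ν B
    mass-∪ A B A⊥B = trans (mass-cong ν (A ∪ B) (⋃ sets) (to , from)) (↝-unique (tends (mass-⋃ ν sets disjoint)) total)
      where
      sets : ℕ → Borel
      sets 0             = A
      sets 1             = B
      sets (suc (suc _)) = ∅
      to : ⟦ A ∪ B ⟧ ⊆ ⟦ ⋃ sets ⟧
      to (zero  , x∈A) = 0 , x∈A
      to (suc _ , x∈B) = 1 , x∈B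
      from : ⟦ ⋃ sets ⟧ ⊆ ⟦ A ∪ B ⟧
      from (0 , x∈A)             = 0 , x∈A
      from (1 , x∈B)             = 1 , x∈B
      from (suc (suc _) , x∈∅)   = ⊥-elim (∉∅ x∈∅)
      disjoint : Disjoint sets
      disjoint 0             0             i≢j _           = i≢j ≡.refl
      disjoint 0             1             _   x∈          = A⊥B x∈
      disjoint 1             0             _   (x∈B , x∈A) = A⊥B (x∈A , x∈B)
      disjoint 1             1             i≢j _           = i≢j ≡.refl
      disjoint (suc (suc _)) _             _   (x∈∅ , _)   = ∉∅ x∈∅
      disjoint 0             (suc (suc _)) _   (_ , x∈∅)   = ∉∅ x∈∅
      disjoint 1             (suc (suc _)) _   (_ , x∈∅)   = ∉∅ x∈∅
      total : (λ k → mass ν (sets k)) ↝ mass ν A + mass ν B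
      total = ↝-cong (λ _ → refl) (+-congˡ (+-identityʳ (mass ν B))) (↝-cons (↝-cons (↝-0 λ _ → mass-∅)))

    mass-split : ∀ A B → mass ν A ≈ mass ν (A ∩ B) + mass ν (A ∩ ∁ B)
    mass-split A B = trans (mass-cong ν A (A ∩ B ∪ A ∩ ∁ B) (to , from))
      (mass-∪ (A ∩ B) (A ∩ ∁ B) λ (x∈A∩B , x∈A∖B) → proj₂ (∈-∩⁻ A (∁ B) x∈A∖B) (proj₂ (∈-∩⁻ A B x∈A∩B)))
      where
      to : ⟦ A ⟧ ⊆ ⟦ A ∩ B ∪ A ∩ ∁ B ⟧
      to {x} x∈A with em {x ∈ ⟦ B ⟧}
      ... | yes x∈B = 0 , ∈-∩⁺ A B x∈A x∈B
      ... | no  x∉B = 1 , ∈-∩⁺ A (∁ B) x∈A x∉B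
      from : ⟦ A ∩ B ∪ A ∩ ∁ B ⟧ ⊆ ⟦ A ⟧
      from (zero  , x∈) = proj₁ (∈-∩⁻ A B x∈)
      from (suc _ , x∈) = proj₁ (∈-∩⁻ A (∁ B) x∈)

    mass-mono : ∀ A B → ⟦ A ⟧ ⊆ ⟦ B ⟧ → mass ν A ≤ mass ν B
    mass-mono A B A⊆B = ≤-by (mass-nonNeg ν (B ∩ ∁ A)) (begin
      mass ν B - mass ν A                                       ≈⟨ +-congʳ (mass-split B A) ⟩
      (mass ν (B ∩ A) + mass ν (B ∩ ∁ A)) - mass ν A            ≈⟨ +-congʳ (+-congʳ (mass-cong ν (B ∩ A) A
                                                                     (proj₂ ∘ ∈-∩⁻ B A , λ x∈A → ∈-∩⁺ B A (A⊆B x∈A) x∈A))) ⟩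
      (mass ν A + mass ν (B ∩ ∁ A)) - mass ν A                  ≈⟨ solve 2 (λ a b → (a :+ b) :- a := b) refl (mass ν A) (mass ν (B ∩ ∁ A)) ⟩
      mass ν (B ∩ ∁ A)                                          ∎)

  module Atoms (ν : ProbabilityMeasure) (ν-discrete : IsDiscrete ν) where

    private
      S = proj₁ ν-discrete
      countable = proj₁ (proj₂ ν-discrete)
      null = proj₂ (proj₂ ν-discrete)

    point : ℕ → ℝ
    point = proj₁ countable

    earlier atom : ℕ → Borel
    earlier zero    = ∅
    earlier (suc k) = earlier k ∪ singleton (point k)
    -- Only the first occurrence of a point in the enumeration gives a nonempty atom.
    atom k = singleton (point k) ∩ ∁ earlier k

    weightOf : ℕ → ℝ
    weightOf k = mass ν (atom k)

    weightOf-nonNeg : ∀ k → 0# ≤ weightOf k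
    weightOf-nonNeg k = mass-nonNeg ν (atom k)

    ∈-atom⁻ : ∀ {x} k → x ∈ ⟦ atom k ⟧ → x ≈ point k
    ∈-atom⁻ k x∈ = ∈-singleton⁻ (proj₁ (∈-∩⁻ (singleton (point k)) (∁ earlier k) x∈))

    -- The order `<′` fits because its constructors descend from `k` just as `earlier` does.
    ∈-earlier⁺ : ∀ {x j k} → j ℕ.<′ k → x ≈ point j → x ∈ ⟦ earlier k ⟧
    ∈-earlier⁺ ℕ.<′-base x≈ = 1 , ∈-singleton⁺ x≈
    ∈-earlier⁺ (ℕ.≤′-step j<k) x≈ = 0 , ∈-earlier⁺ j<k x≈

    -- A search for the first occurrence of `x`: the index is lowered while `x` remains in
    -- `earlier k`, and where this stops `x` lies in `atom k`.
    ∈-earlier⁻ : ∀ {x} k → x ∈ ⟦ earlier k ⟧ → x ∈ ⟦ ⋃ atom ⟧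
    ∈-earlier⁻ zero    x∈∅ = ⊥-elim (∉∅ x∈∅)
    ∈-earlier⁻ {x} (suc k) x∈ with em {x ∈ ⟦ earlier k ⟧} | ∈-∪⁻ (earlier k) (singleton (point k)) x∈
    ... | yes x∈earlier | _             = ∈-earlier⁻ k x∈earlier
    ... | no  x∉earlier | inj₁ x∈earlier = ⊥-elim (x∉earlier x∈earlier)
    ... | no  x∉earlier | inj₂ x∈point  = k , ∈-∩⁺ (singleton (point k)) (∁ earlier k) x∈point x∉earlier

    atom-disjoint : Disjoint atom
    atom-disjoint i j i≢j (x∈ᵢ , x∈ⱼ) with ℕₚ.<-cmp i j
    ... | tri< i<j _ _ = proj₂ (∈-∩⁻ (singleton (point j)) (∁ earlier j) x∈ⱼ) (∈-earlier⁺ (ℕₚ.<⇒<′ i<j) (∈-atom⁻ i x∈ᵢ))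
    ... | tri≈ _ i≡j _ = i≢j i≡j
    ... | tri> _ _ j<i = proj₂ (∈-∩⁻ (singleton (point i)) (∁ earlier i) x∈ᵢ) (∈-earlier⁺ (ℕₚ.<⇒<′ j<i) (∈-atom⁻ j x∈ⱼ))

    S⊆⋃atom : ⟦ S ⟧ ⊆ ⟦ ⋃ atom ⟧
    S⊆⋃atom {x} x∈S = let k , x≈ = proj₂ countable x x∈S in
      ∈-earlier⁻ (suc k) (∈-earlier⁺ {k = suc k} ℕ.<′-base x≈)

    -- All elements of an atom equal `point k`, so `B` either contains the atom or misses it.
    mass-∩-atom : ∀ B k → mass ν (B ∩ atom k) ≈ weightOf k * δ (point k) B
    mass-∩-atom B k with em {point k ∈ ⟦ B ⟧}
    ... | yes pₖ∈B = trans
      (mass-cong ν (B ∩ atom k) (atom k) (proj₂ ∘ ∈-∩⁻ B (atom k) ,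
        λ x∈ → ∈-∩⁺ B (atom k) (∈-resp-≈ B (sym (∈-atom⁻ k x∈)) pₖ∈B) x∈))
      (sym (*-identityʳ (weightOf k)))
    ... | no pₖ∉B = trans
      (mass-cong ν (B ∩ atom k) ∅ ((λ x∈ → let x∈B , x∈atom = ∈-∩⁻ B (atom k) x∈ in
        ⊥-elim (pₖ∉B (∈-resp-≈ B (∈-atom⁻ k x∈atom) x∈B))) , λ x∈∅ → ⊥-elim (∉∅ x∈∅)))
      (trans (mass-∅ ν) (sym (zeroʳ (weightOf k))))

    -- The part of `B` outside all atoms lies in the null set `∁ S`; on the rest countable
    -- additivity applies.
    mass-expansion : ∀ B → (λ k → weightOf k * δ (point k) B) ↝ mass ν B
    mass-expansion B = ↝-cong (mass-∩-atom B) ⋃≈B (tends (mass-⋃ ν (λ k → B ∩ atom k)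
      λ i j i≢j (x∈ᵢ , x∈ⱼ) → atom-disjoint i j i≢j (proj₂ (∈-∩⁻ B (atom i) x∈ᵢ) , proj₂ (∈-∩⁻ B (atom j) x∈ⱼ))))
      where
      remainder-null : mass ν (B ∩ ∁ ⋃ atom) ≈ 0#
      remainder-null = ≤-antisym
        (≤-respʳ-≈ null (mass-mono ν (B ∩ ∁ ⋃ atom) (∁ S) λ x∈ x∈S → proj₂ (∈-∩⁻ B (∁ ⋃ atom) x∈) (S⊆⋃atom x∈S)))
        (mass-nonNeg ν (B ∩ ∁ ⋃ atom))
      ⋃≈B : mass ν (⋃ λ k → B ∩ atom k) ≈ mass ν B
      ⋃≈B = begin
        mass ν (⋃ λ k → B ∩ atom k)                         ≈⟨ mass-cong ν (⋃ λ k → B ∩ atom k) (B ∩ ⋃ atom)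
                                                                 ( (λ (k , x∈) → let x∈B , x∈atom = ∈-∩⁻ B (atom k) x∈ in
                                                                                 ∈-∩⁺ B (⋃ atom) x∈B (k , x∈atom))
                                                                 , (λ x∈ → let x∈B , k , x∈atom = ∈-∩⁻ B (⋃ atom) x∈ in
                                                                           k , ∈-∩⁺ B (atom k) x∈B x∈atom)) ⟩
        mass ν (B ∩ ⋃ atom)                                 ≈⟨ +-identityʳ _ ⟨
        mass ν (B ∩ ⋃ atom) + 0#                            ≈⟨ +-congˡ remainder-null ⟨
        mass ν (B ∩ ⋃ atom) + mass ν (B ∩ ∁ ⋃ atom)         ≈⟨ mass-split ν B (⋃ atom) ⟨
        mass ν B                                            ∎

    -- From above, every partial sum is itself a lower sum, hence at most `a`. From below, some
    -- lower sum exceeds `a - ε`; expanded over the atoms, it is a series dominated term by term by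
    -- the one in question.
    integral-expansion : (f : ℝ → ℝ) → (∀ {x y} → x ≈ y → f x ≈ f y) → (∀ x → 0# ≤ f x) →
                         ∀ {a} → IsSup (IsLowerSum ν f) a → (λ k → weightOf k * f (point k)) ↝ a
    integral-expansion f f-cong 0≤f {a} (isBound , isLeast) = tends λ ε 0<ε →
      let t , (p , c , B , 0≤c , disjoint , c≤f , t≈) , a-ε<t = approximation ε 0<ε
          t′ = ∑ (λ i → c i * mass ν (B i))
          -- The margin of the lower sum over `a - ε`: convergence within `ε′` of `t′` keeps the
          -- partial sums above `a - ε`.
          ε′ = t′ - (a - ε)
          simple↝ : (λ k → ∑ (λ i → c i * (weightOf k * δ (point k) (B i)))) ↝ t′
          simple↝ = ↝-∑ λ i → ↝-* (c i) (mass-expansion (B i))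
          simple≤ : ∀ k → ∑ (λ i → c i * (weightOf k * δ (point k) (B i))) ≤ weightOf k * f (point k)
          simple≤ k = ≤-respˡ-≈
            (trans (*-distribˡ-sum (weightOf k) (λ i → c i * δ (point k) (B i)))
              (∑-cong {p} λ i → solve 3 (λ w c d → w :* (c :* d) := c :* (w :* d)) refl (weightOf k) (c i) (δ (point k) (B i))))
            (*-monoˡ (weightOf-nonNeg k) (simpleFunction-≤ c B f disjoint c≤f (point k) (0≤f (point k))))
          t′-ε′≈a-ε : t′ - ε′ ≈ a - ε
          t′-ε′≈a-ε = solve 2 (λ t b → t :- (t :- b) := b) refl t′ (a - ε)
          N , close = sumsTo simple↝ ε′ (<⇒0<- (<-respʳ-≈ t≈ a-ε<t))
      in N , λ k N≤k →
        <-≤-trans (<-respˡ-≈ t′-ε′≈a-ε (proj₁ (close k N≤k))) (∑-mono {k} λ i → simple≤ (toℕ i)) ,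
        ≤-<-trans (isBound _ (partialSum-isLowerSum k)) (x<x+ε 0<ε)
      where
      partialSum-isLowerSum : ∀ k → IsLowerSum ν f (partialSum (λ k → weightOf k * f (point k)) k)
      partialSum-isLowerSum k = k , (λ i → f (point (toℕ i))) , (λ i → atom (toℕ i)) ,
        (λ i → 0≤f (point (toℕ i))) ,
        (λ i j i≢j → atom-disjoint (toℕ i) (toℕ j) (i≢j ∘ toℕ-injective)) ,
        (λ i x x∈ → ≤-reflexive (f-cong (sym (∈-atom⁻ (toℕ i) x∈)))) ,
        ∑-cong {k} λ i → *-comm (weightOf (toℕ i)) (f (point (toℕ i)))

      approximation : ∀ ε → 0# < ε → Σ[ t ∈ ℝ ] IsLowerSum ν f t × a - ε < t
      approximation ε 0<ε = stable λ none → <⇒≱ (x-ε<x 0<ε) (isLeast (a - ε) λ t t-lower → ≮⇒≥ λ a-ε<t → none (t , t-lower , a-ε<t))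

    hasIntegral⇒↝ : (f : ℝ → ℝ) → (∀ {x y} → x ≈ y → f x ≈ f y) → ∀ {r} → HasIntegral ν f r →
                    (λ k → weightOf k * f (point k)) ↝ r
    hasIntegral⇒↝ f f-cong (_ , a , b , a-sup , b-sup , r≈a-b) = ↝-cong
      (λ k → trans
        (solve 3 (λ w p q → w :* p :+ (:- (w :* q)) := w :* (p :- q)) refl (weightOf k) (f (point k) ⊔ 0#) ((- f (point k)) ⊔ 0#))
        (*-congˡ (positivePart-negativePart (f (point k)))))
      (sym r≈a-b)
      (↝-+ (integral-expansion (λ x → f x ⊔ 0#) (λ x≈y → ⊔0-cong (f-cong x≈y)) (λ x → ⊔0-nonNeg (f x)) a-sup)
           (↝-neg (integral-expansion (λ x → (- f x) ⊔ 0#) (λ x≈y → ⊔0-cong (-‿cong (f-cong x≈y))) (λ x → ⊔0-nonNeg (- f x)) b-sup)))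

-- Polynomials, and uniqueness of the measure with given moments.

module Moments (em : ExcludedMiddle 0ℓ) (𝓡 : CompleteOrderedField) where
  open OrderedField em 𝓡
  open Series em 𝓡
  open BorelSets em 𝓡
  open Integration em 𝓡
  open DiscreteMeasures em 𝓡
  open Measure 𝓡
  open import Relation.Binary.Reasoning.Setoid setoid

  rootProduct : ∀ {n} → Vector ℝ n → ℝ → ℝ
  rootProduct {zero}  a x = 1#
  rootProduct {suc n} a x = (x - a zero) * rootProduct (a ∘ suc) x

  rootProduct-root : ∀ {n} (a : Vector ℝ n) i → rootProduct a (a i) ≈ 0#
  rootProduct-root a zero    = trans (*-congʳ (-‿inverseʳ (a zero))) (zeroˡ _)
  rootProduct-root a (suc i) = trans (*-congˡ (rootProduct-root (a ∘ suc) i)) (zeroʳ _)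

  rootProduct≈0⇒root : ∀ {n} (a : Vector ℝ n) x → rootProduct a x ≈ 0# → Σ[ i ∈ Fin n ] x ≈ a i
  rootProduct≈0⇒root {zero}  a x 1≈0 = ⊥-elim (0≉1 (sym 1≈0))
  rootProduct≈0⇒root {suc n} a x p≈0 with em {x - a zero ≈ 0#}
  ... | yes x-a≈0 = zero , trans (solve 2 (λ x y → x := (x :- y) :+ y) refl x (a zero)) (trans (+-congʳ x-a≈0) (+-identityˡ _))
  ... | no  x-a≉0 = let i , x≈aᵢ = rootProduct≈0⇒root (a ∘ suc) x (noZeroDivisors x-a≉0 p≈0) in suc i , x≈aᵢ

  module _ {s} (a ω : Vector ℝ s) (point w : ℕ → ℝ) where

    -- The series ∑ wₖ f(pₖ) and the finite sum ∑ ωᵢ f(aᵢ) agree, also after multiplying f by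
    -- a power of x; the latter makes the condition stable under multiplication by x.
    record Matches (f : ℝ → ℝ) : Set where
      field
        cong    : ∀ {x y} → x ≈ y → f x ≈ f y
        moments : ∀ m → (λ k → w k * (point k ^ m * f (point k))) ↝ ∑ (λ i → ω i * (a i ^ m * f (a i)))
    open Matches

    matches-resp : ∀ {f g} → (∀ x → f x ≈ g x) → Matches f → Matches g
    matches-resp f≈g F .cong x≈y = trans (sym (f≈g _)) (trans (F .cong x≈y) (f≈g _))
    matches-resp f≈g F .moments m =
      ↝-cong (λ k → *-congˡ (*-congˡ (f≈g (point k)))) (∑-cong λ i → *-congˡ (*-congˡ (f≈g (a i)))) (F .moments m)

    matches-+ : ∀ {f g} → Matches f → Matches g → Matches (λ x → f x + g x)
    matches-+ F G .cong x≈y = +-cong (F .cong x≈y) (G .cong x≈y)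
    matches-+ {f} {g} F G .moments m =
      ↝-cong (λ k → distrib (w k) (point k ^ m) (f (point k)) (g (point k)))
        (trans (sym (∑-distrib-+ (λ i → ω i * (a i ^ m * f (a i))) (λ i → ω i * (a i ^ m * g (a i)))))
               (∑-cong {s} λ i → distrib (ω i) (a i ^ m) (f (a i)) (g (a i))))
        (↝-+ (F .moments m) (G .moments m))
      where
      distrib : ∀ u v x y → u * (v * x) + u * (v * y) ≈ u * (v * (x + y))
      distrib = solve 4 (λ u v x y → u :* (v :* x) :+ u :* (v :* y) := u :* (v :* (x :+ y))) refl

    matches-* : ∀ {f} c → Matches f → Matches (λ x → c * f x)
    matches-* c F .cong x≈y = *-congˡ (F .cong x≈y)
    matches-* {f} c F .moments m =
      ↝-cong (λ k → rearrange (w k) (point k ^ m) (f (point k)))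
        (trans (*-distribˡ-sum c (λ i → ω i * (a i ^ m * f (a i)))) (∑-cong {s} λ i → rearrange (ω i) (a i ^ m) (f (a i))))
        (↝-* c (F .moments m))
      where
      rearrange : ∀ u v x → c * (u * (v * x)) ≈ u * (v * (c * x))
      rearrange = solve 4 (λ c u v x → c :* (u :* (v :* x)) := u :* (v :* (c :* x))) refl c

    matches-x : ∀ {f} → Matches f → Matches (λ x → x * f x)
    matches-x F .cong x≈y = *-cong x≈y (F .cong x≈y)
    matches-x {f} F .moments m =
      ↝-cong (λ k → rearrange (w k) (point k) (point k ^ m) (f (point k)))
        (∑-cong {s} λ i → rearrange (ω i) (a i) (a i ^ m) (f (a i)))
        (F .moments (suc m))
      where
      rearrange : ∀ u x v y → u * (x * v * y) ≈ u * (v * (x * y))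
      rearrange = solve 4 (λ u x v y → u :* (x :* v :* y) := u :* (v :* (x :* y))) refl

    -- The cofactor `f` is carried along so that a second application yields the square of the
    -- product.
    matches-rootProduct : ∀ {n f} (b : Vector ℝ n) → Matches f → Matches (λ x → rootProduct b x * f x)
    matches-rootProduct {zero}  {f} b F = matches-resp (λ x → sym (*-identityˡ (f x))) F
    matches-rootProduct {suc n} {f} b F = matches-resp
      (λ x → solve 4 (λ x b p y → x :* (p :* y) :+ (:- b) :* (p :* y) := (x :- b) :* p :* y) refl
               x (b zero) (rootProduct (b ∘ suc) x) (f x))
      (matches-+ (matches-x G) (matches-* (- b zero) G))
      where
      G : Matches (λ x → rootProduct (b ∘ suc) x * f x)
      G = matches-rootProduct (b ∘ suc) F

    matches-limit : ∀ {f} → Matches f → (λ k → w k * f (point k)) ↝ ∑ (λ i → ω i * f (a i))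
    matches-limit {f} F =
      ↝-cong (λ k → *-congˡ (*-identityˡ (f (point k)))) (∑-cong λ i → *-congˡ (*-identityˡ (f (a i)))) (F .moments 0)

    module _ (w-nonNeg : ∀ k → 0# ≤ w k)
             (power-moments : ∀ m → (λ k → w k * point k ^ m) ↝ ∑ (λ i → ω i * a i ^ m)) where

      matches-1 : Matches (λ _ → 1#)
      matches-1 .cong _ = refl
      matches-1 .moments m =
        ↝-cong (λ k → *-congˡ (sym (*-identityʳ (point k ^ m))))
          (∑-cong λ i → *-congˡ (sym (*-identityʳ (a i ^ m)))) (power-moments m)

      -- Newton interpolation: the correction for a new node vanishes at the others.
      interpolation : ∀ {n} (b : Vector ℝ n) → Injective _≡_ _≈_ b → (y : Vector ℝ n) →
                      Σ[ f ∈ (ℝ → ℝ) ] Matches f × (∀ i → f (b i) ≈ y i)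
      -- Without nodes any matching function will do.
      interpolation {zero}  b b-injective y = (λ _ → 1#) , matches-1 , λ ()
      interpolation {suc n} b b-injective y =
        let f , F , f≈y = interpolation (b ∘ suc) (λ eq → suc-injective (b-injective eq)) (y ∘ suc)
            p⁻¹ , pp⁻¹≈1 = inverse (p (b zero)) p≉0
            c = (y zero - f (b zero)) * p⁻¹
            -- The factor `1#` is the cofactor left by `matches-rootProduct` applied to `matches-1`.
            g = λ x → f x + c * (p x * 1#)
            at-head : g (b zero) ≈ y zero
            at-head = begin
              f (b zero) + (y zero - f (b zero)) * p⁻¹ * (p (b zero) * 1#)
                ≈⟨ solve 4 (λ u v q p → u :+ (v :- u) :* q :* (p :* :1) := u :+ (v :- u) :* (p :* q)) refl
                    (f (b zero)) (y zero) p⁻¹ (p (b zero)) ⟩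
              f (b zero) + (y zero - f (b zero)) * (p (b zero) * p⁻¹)
                ≈⟨ +-congˡ (*-congˡ pp⁻¹≈1) ⟩
              f (b zero) + (y zero - f (b zero)) * 1#
                ≈⟨ solve 2 (λ u v → u :+ (v :- u) :* :1 := v) refl (f (b zero)) (y zero) ⟩
              y zero ∎
            at-tail : ∀ i → g (b (suc i)) ≈ y (suc i)
            at-tail i = begin
              f (b (suc i)) + c * (p (b (suc i)) * 1#)  ≈⟨ +-cong (f≈y i) (*-congˡ (*-congʳ (rootProduct-root (b ∘ suc) i))) ⟩
              y (suc i) + c * (0# * 1#)                 ≈⟨ solve 2 (λ y c → y :+ c :* (:0 :* :1) := y) refl (y (suc i)) c ⟩
              y (suc i)                                 ∎
        in g , matches-+ F (matches-* c (matches-rootProduct (b ∘ suc) matches-1)) ,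
           λ { zero → at-head ; (suc i) → at-tail i }
        where
        p : ℝ → ℝ
        p = rootProduct (b ∘ suc)
        p≉0 : p (b zero) ≉ 0#
        p≉0 p≈0 with rootProduct≈0⇒root (b ∘ suc) (b zero) p≈0
        ... | i , b₀≈bᵢ₊₁ with b-injective b₀≈bᵢ₊₁
        ...   | ()

      -- The integral of the square of a polynomial vanishing at all aᵢ is zero.
      concentrated : ∀ k → w k ≉ 0# → Σ[ i ∈ Fin s ] point k ≈ a i
      concentrated k wₖ≉0 = rootProduct≈0⇒root a (point k)
        (stable λ p≉0 → p≉0 (noZeroDivisors p≉0 (noZeroDivisors wₖ≉0 wp²≈0)))
        where
        p : ℝ → ℝ
        p = rootProduct a
        square-series : (λ k → w k * (p (point k) * p (point k))) ↝ 0#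
        square-series = ↝-cong
          (λ k → *-congˡ (*-congˡ (*-identityʳ (p (point k)))))
          (∑-zero λ i → trans (*-congˡ (trans (*-congʳ (rootProduct-root a i)) (zeroˡ _))) (zeroʳ (ω i)))
          (matches-limit (matches-rootProduct a (matches-rootProduct a matches-1)))
        terms-nonNeg : ∀ k → 0# ≤ w k * (p (point k) * p (point k))
        terms-nonNeg k = *-nonNeg _ _ (w-nonNeg k) (square-nonNeg (p (point k)))
        wp²≈0 : w k * (p (point k) * p (point k)) ≈ 0#
        wp²≈0 = ≤-antisym (term≤limit terms-nonNeg square-series k) (terms-nonNeg k)

      -- Off the nodes the interpolant may differ from the indicator of `B`, but there the weights
      -- vanish, so the two series agree term by term.
      δ-series : Injective _≡_ _≈_ a → ∀ B → (λ k → w k * δ (point k) B) ↝ ∑ (λ i → ω i * δ (a i) B)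
      δ-series a-injective B =
        let f , F , f≈δ = interpolation a a-injective (λ i → δ (a i) B)
            agree : ∀ k → w k * f (point k) ≈ w k * δ (point k) B
            agree k = [ (λ wₖ≈0 → trans (*-congʳ wₖ≈0) (trans (zeroˡ _) (sym (trans (*-congʳ wₖ≈0) (zeroˡ _)))))
                      , (λ (i , pₖ≈aᵢ) → *-congˡ (trans (F .cong pₖ≈aᵢ) (trans (f≈δ i)
                          (δ-cong B B (sym pₖ≈aᵢ) ((λ x∈B → x∈B) , λ x∈B → x∈B)))))
                      ]′ (support k)
        in ↝-cong agree (∑-cong λ i → *-congˡ (f≈δ i)) (matches-limit F)
        where
        support : ∀ k → w k ≈ 0# ⊎ (Σ[ i ∈ Fin s ] point k ≈ a i)
        support k with em {w k ≈ 0#}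
        ... | yes wₖ≈0 = inj₁ wₖ≈0
        ... | no  wₖ≉0 = inj₂ (concentrated k wₖ≉0)

  -- Both sides are limits of one series: by `mass-expansion` for the measure, by `δ-series` for the
  -- finite sum.
  discreteMeasure-unique :
    ∀ {s} (a ω : Vector ℝ s) → Injective _≡_ _≈_ a → (ν : ProbabilityMeasure) → IsDiscrete ν →
    (∀ m → HasIntegral ν (_^ m) (∑ (λ i → ω i * a i ^ m))) → ∀ B → mass ν B ≈ ∑ (λ i → ω i * δ (a i) B)
  discreteMeasure-unique a ω a-injective ν ν-discrete moments B = ↝-unique (mass-expansion B)
    (δ-series a ω point weightOf weightOf-nonNeg (λ m → hasIntegral⇒↝ (_^ m) (^-cong m) (moments m)) a-injective B)
    where open Atoms ν ν-discrete

-- The spectral measure of the vector state.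

theorem3p5 :
  (em : ExcludedMiddle 0ℓ) (𝓡 : CompleteOrderedField) →
  let open Complex 𝓡
      open Measure 𝓡
  in
  (n : ℕ) → 1 ℕ.≤ n →
  (ξ : ℂ^ n) → IsUnit ξ →
  (A : M n) → IsHermitian A →
  (s : ℕ) (eigval : Vector ℝ s) (mult : Vector ℕ s) →
  Injective _≡_ _≈_ eigval →
  (∀ i → IsEigenvalue A (ofReal (eigval i))) →
  (∀ z → IsEigenvalue A z → Σ[ i ∈ Fin s ] z ≈ᶜ ofReal (eigval i)) →
  (∀ i → HasMultiplicity A (ofReal (eigval i)) (mult i)) →
  (dim : ∑ℕ mult ≡ n) →
  (Us : ∀ i → Matrix n (mult i)) →
  (∀ i j → IsUnit (col (Us i) j)) →
  (∀ i j → IsEigenvector A (ofReal (eigval i)) (col (Us i) j)) →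
  let Λ = subst M dim (⨁ mult (λ i → scalar (ofReal (eigval i))))
      U = subst (Matrix n) dim (hcat mult Us)
  in
  IsUnitary U →
  A ≈ᴹ U · Λ · U ᴴ →
  Σ[ unique ∈ ∃! _≈ᵐ_ (λ μ →
      IsDiscrete μ ×
      (∀ k → Σ[ r ∈ ℝ ] HasIntegral μ (_^ k) r × vectorState ξ (A ^ᴹ k) ≈ᶜ ofReal r)) ]
  Σ[ ω ∈ Vector ℝ s ]
    (∀ B → mass (proj₁ unique) B ≈ ∑ (λ i → ω i * Dirac em (eigval i) B)) ×
    (∀ i → ω i ≈ ∑ (λ j → ∣ cosAngle (col (Us i) j) ξ ∣²))
theorem3p5 em 𝓡 n _ ξ ξ-unit A _ s eigval mult eigval-injective _ _ _ dim Us _ eigen (_ , UUᴴ≈I) _ =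
  (measure , (isDiscrete , λ k → _ , hasIntegral (_^ k) (^-cong k) (^-isMeasurable k) , state-moments k) , λ {ν} → unique {ν}) ,
  ω , (λ B → refl) , λ i → refl
  where
  open Complex 𝓡
  open Measure 𝓡
  open OrderedField em 𝓡 using (refl; sym; trans; ∑-cong; *-identityʳ)
  open BorelSets em 𝓡 using (^-cong; ^-isMeasurable)
  open ComplexField em 𝓡
  open Integration em 𝓡
  open Moments em 𝓡

  ω : Vector ℝ s
  ω = weight ξ mult Us

  state-moments : ∀ k → vectorState ξ (A ^ᴹ k) ≈ᶜ ofReal (∑ (λ i → ω i * eigval i ^ k))
  state-moments = vectorState-moments ξ A eigval mult dim Us (λ i j → proj₂ (eigen i j)) UUᴴ≈I

  -- The zeroth moment: the total weight is the state of the identity matrix, that is, the squared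
  -- norm of `ξ`.
  ∑ω≈1 : ∑ ω ≈ 1#
  ∑ω≈1 = trans (∑-cong λ i → sym (*-identityʳ (ω i))) (trans (sym (proj₁ (state-moments 0)))
    (trans (proj₁ (⟨⟩-cong {u = ξ} (I·ᵛ ξ))) (proj₁ ξ-unit)))

  open FiniteAtomic eigval eigval-injective ω (weight-nonNeg ξ mult Us) ∑ω≈1

  unique : ∀ {ν} → IsDiscrete ν × (∀ k → Σ[ r ∈ ℝ ] HasIntegral ν (_^ k) r × vectorState ξ (A ^ᴹ k) ≈ᶜ ofReal r) → measure ≈ᵐ ν
  unique {ν} (ν-discrete , ν-moments) B = sym (discreteMeasure-unique eigval ω eigval-injective ν ν-discrete moments B)
    where
    moments : ∀ m → HasIntegral ν (_^ m) (∑ (λ i → ω i * eigval i ^ m))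
    moments m with ν-moments m
    -- The moment `r` of `ν` comes as an unspecified real; comparing real parts of the two values of
    -- the state identifies it with the finite sum.
    ... | r , (measurable , a , b , a-sup , b-sup , r≈) , state≈r =
      measurable , a , b , a-sup , b-sup , trans (sym (proj₁ (state-moments m))) (trans (proj₁ state≈r) r≈)
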